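{- Let $T$ be a rational pinwheel tiling with associated planar graph $RP$. Then the chromatic number of $RP$ is $\chi(RP)=3$.
   Context: Rational pinwheel substitution. The prototile $K$ is the right triangle with side lengths $1,2,\sqrt5$. The substitution $\omega$ expands a tile by $\sqrt5$ and dissects it into five tiles: the expanded tile, placed as the triangle with vertices $(0,0)$ (right angle), $(2,-1)$, $(2,4)$, is dissected into the triangles with vertices $\{(2,-1),(2,0),(0,0)\}$, $\{(0,0),(1,0),(1,2)\}$, $\{(1,0),(2,0),(2,2)\}$, $\{(1,0),(1,2),(2,2)\}$, $\{(1,2),(2,2),(2,4)\}$. The rule is extended to all congruent copies of $K$ (including reflections) and to collections of tiles covariantly. A rational pinwheel tiling is a tiling $T$ of $\mathbb{R}^2$ by congruent copies of $K$ such that every finite set of tiles of $T$ is contained in a congruent copy of $\omega^n(K)$ for some $n\ge0$. Graph: the vertices are all points that are a corner of at least one tile; the edges are the segments, contained in tile boundaries, joining consecutive vertices (so a tile side containing vertices in its interior is subdivided by them). -}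

module Defs where

open import Level using (0ℓ) renaming (suc to lsuc)
open import Algebra.Bundles using (CommutativeRing)
open import Data.Fin.Base using (Fin)
open import Data.List.Base using (List; []; _∷_; map; concatMap)
open import Data.List.Relation.Unary.All using (All)
open import Data.List.Relation.Unary.Any as Any using (Any)
open import Data.Nat.Base as ℕ using (ℕ)
open import Data.Nat.GeneralisedArithmetic using (fold)
open import Data.Product.Base using (Σ; _×_; _,_; proj₁; ∃; ∃-syntax)
open import Data.Product.Relation.Binary.Pointwise.NonDependent using (×-setoid)
open import Function.Definitions using (Congruent)
open import Relation.Binary.Bundles using (Setoid)
open import Relation.Binary.Core using (Rel)
open import Relation.Binary.Definitions using (Symmetric; Irreflexive; _Respects₂_)
open import Relation.Binary.PropositionalEquality using (_≡_; _≢_)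
open import Relation.Binary.Structures using (IsTotalOrder)
import Relation.Binary.Construct.On as On
open import Relation.Nullary.Negation.Core using (¬_)
open import Relation.Unary using (Pred; Satisfiable)

-- The real numbers, axiomatised up to isomorphism as a Dedekind-complete
-- ordered field.  The value of x ⁻¹ is unconstrained when x ≈ 0#.
record CompleteOrderedField : Set (lsuc 0ℓ) where
  infix 4 _≤_ _<_
  infix 8 _⁻¹
  field
    commutativeRing : CommutativeRing 0ℓ 0ℓ

  open CommutativeRing commutativeRing public

  field
    _⁻¹          : Carrier → Carrier
    ⁻¹-inverse   : ∀ {x} → ¬ (x ≈ 0#) → x * x ⁻¹ ≈ 1#
    1≉0          : ¬ (1# ≈ 0#)
    _≤_          : Rel Carrier 0ℓ
    isTotalOrder : IsTotalOrder _≈_ _≤_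
    +-monoˡ-≤    : ∀ {x y} z → x ≤ y → x + z ≤ y + z
    *-nonneg     : ∀ {x y} → 0# ≤ x → 0# ≤ y → 0# ≤ x * y

  IsUpperBound : Pred Carrier 0ℓ → Pred Carrier 0ℓ
  IsUpperBound P u = ∀ x → P x → x ≤ u

  field
    complete : (P : Pred Carrier 0ℓ) → Satisfiable P → Satisfiable (IsUpperBound P) →
               ∃[ s ] IsUpperBound P s × (∀ u → IsUpperBound P u → s ≤ u)

  _<_ : Rel Carrier 0ℓ
  x < y = x ≤ y × ¬ (x ≈ y)

  2# 4# 5# 10# : Carrier
  2#  = 1# + 1#
  4#  = 2# + 2#
  5#  = 4# + 1#
  10# = 5# + 5#

  IsSquareRoot : Carrier → Carrier → Set
  IsSquareRoot a s = 0# ≤ s × s * s ≈ a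

record Graph : Set (lsuc 0ℓ) where
  field
    vertices : Setoid 0ℓ 0ℓ

  open Setoid vertices using (_≈_) renaming (Carrier to Vertex) public

  field
    Adjacent : Rel Vertex 0ℓ
    resp     : Adjacent Respects₂ _≈_
    irrefl   : Irreflexive _≈_ Adjacent
    sym      : Symmetric Adjacent

Colourable : Graph → ℕ → Set
Colourable G k =
  Σ (Vertex → Fin k) λ c →
    Congruent _≈_ _≡_ c × (∀ {u v} → Adjacent u v → c u ≢ c v)
  where open Graph G

HasChromaticNumber : Graph → ℕ → Set
HasChromaticNumber G k = Colourable G k × (∀ m → Colourable G m → k ℕ.≤ m)

module Plane (ℝ : CompleteOrderedField) where
  open CompleteOrderedField ℝ hiding (sym)
  private module ≈ = CompleteOrderedField ℝ using (refl; sym; trans)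

  pointSetoid : Setoid 0ℓ 0ℓ
  pointSetoid = ×-setoid setoid setoid

  open Setoid pointSetoid public using () renaming (Carrier to Point; _≈_ to _≈ₚ_)
  private module ≈ₚ = Setoid pointSetoid

  infixl 6 _+ₚ_ _-ₚ_
  infixr 7 _·_

  _+ₚ_ _-ₚ_ : Point → Point → Point
  (x , y) +ₚ (x′ , y′) = x + x′ , y + y′
  (x , y) -ₚ (x′ , y′) = x - x′ , y - y′

  _·_ : Carrier → Point → Point
  k · (x , y) = k * x , k * y

  dist² : Point → Point → Carrier
  dist² (x , y) (x′ , y′) = (x - x′) * (x - x′) + (y - y′) * (y - y′)

  -- Preserving squared distances is the same as preserving distances.
  -- Orientation-reversing maps are included.
  IsIsometry : (Point → Point) → Set
  IsIsometry f = ∀ p q → dist² (f p) (f q) ≈ dist² p q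

  OnSegment StrictlyBetween : Point → Point → Pred Point 0ℓ
  OnSegment u v p =
    ∃[ α ] ∃[ β ] 0# ≤ α × 0# ≤ β × α + β ≈ 1# × p ≈ₚ α · u +ₚ β · v
  StrictlyBetween u v p =
    ∃[ α ] ∃[ β ] 0# < α × 0# < β × α + β ≈ 1# × p ≈ₚ α · u +ₚ β · v

  -- The triangles that occur are similar to K, hence scalene, so a triangle
  -- is determined as a set by the following labelled corners: the right angle,
  -- the other end of the shorter leg, the other end of the longer leg.
  record Triangle : Set where
    constructor △
    field
      right short long : Point

  open Triangle public

  infix 4 _≈△_
  _≈△_ : Rel Triangle 0ℓ
  t ≈△ u = right t ≈ₚ right u × short t ≈ₚ short u × long t ≈ₚ long u

  corners : Triangle → List Point
  corners (△ a b c) = a ∷ b ∷ c ∷ []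

  sides : Triangle → List (Point × Point)
  sides (△ a b c) = (a , b) ∷ (a , c) ∷ (b , c) ∷ []

  InTriangle InInterior : Triangle → Pred Point 0ℓ
  InTriangle (△ a b c) p =
    ∃[ α ] ∃[ β ] ∃[ γ ] 0# ≤ α × 0# ≤ β × 0# ≤ γ × α + β + γ ≈ 1# ×
      p ≈ₚ α · a +ₚ β · b +ₚ γ · c
  InInterior (△ a b c) p =
    ∃[ α ] ∃[ β ] ∃[ γ ] 0# < α × 0# < β × 0# < γ × α + β + γ ≈ 1# ×
      p ≈ₚ α · a +ₚ β · b +ₚ γ · c

  mapTriangle : (Point → Point) → Triangle → Triangle
  mapTriangle f (△ a b c) = △ (f a) (f b) (f c)

  K : Triangle
  K = △ (0# , 0#) (1# , 0#) (0# , 2#)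

  IsTile : Pred Triangle 0ℓ
  IsTile t = ∃[ f ] IsIsometry f × t ≈△ mapTriangle f K

  record IsTiling (T : Pred Triangle 0ℓ) : Set where
    field
      resp     : ∀ {t u} → t ≈△ u → T t → T u
      tiles    : ∀ {t} → T t → IsTile t
      covers   : ∀ p → ∃[ t ] T t × InTriangle t p
      disjoint : ∀ {t u} → T t → T u → ∀ p → InInterior t p → InInterior u p → t ≈△ u

  pieces : List Triangle
  pieces =
    △ (2# , 0#) (2# , - 1#) (0# , 0#) ∷
    △ (1# , 0#) (0# , 0#)   (1# , 2#) ∷
    △ (2# , 0#) (1# , 0#)   (2# , 2#) ∷
    △ (1# , 2#) (2# , 2#)   (1# , 0#) ∷
    △ (2# , 2#) (1# , 2#)   (2# , 4#) ∷ []

  -- The affine map taking (0,0), (2,-1), (2,4) to the corners of the triangle: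
  -- (x,y) = (2x-y)/5 (2,-1) + (x+2y)/10 (2,4).
  place : Triangle → Point → Point
  place (△ a b c) (x , y) =
    a +ₚ ((2# * x - y) * 5# ⁻¹) · (b -ₚ a) +ₚ ((x + 2# * y) * 10# ⁻¹) · (c -ₚ a)

  dissect : Triangle → List Triangle
  dissect t = map (mapTriangle (place t)) pieces

  -- s is the expansion factor; the substitution is ω √5.
  ω : Carrier → List Triangle → List Triangle
  ω s = concatMap (λ t → dissect (mapTriangle (s ·_) t))

  ω^ : Carrier → ℕ → List Triangle → List Triangle
  ω^ s n ts = fold ts (ω s) n

  record IsRationalPinwheelTiling (√5 : Carrier) (T : Pred Triangle 0ℓ) : Set where
    field
      isTiling : IsTiling T
      patches  : ∀ ts → All T ts →
                 ∃[ n ] ∃[ f ] IsIsometry f ×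
                   All (λ t → Any (λ u → t ≈△ mapTriangle f u) (ω^ √5 n (K ∷ []))) ts

  module _ (T : Pred Triangle 0ℓ) where

    IsVertex : Pred Point 0ℓ
    IsVertex p = ∃[ t ] T t × Any (p ≈ₚ_) (corners t)

    IsEdge : Rel Point 0ℓ
    IsEdge p q =
      ¬ (p ≈ₚ q) ×
      (∃[ t ] T t × Any (λ (u , v) → OnSegment u v p × OnSegment u v q) (sides t)) ×
      (∀ w → IsVertex w → ¬ StrictlyBetween p q w)

    private
      on-resp : ∀ {u v p q} → p ≈ₚ q → OnSegment u v p → OnSegment u v q
      on-resp p≈q (α , β , h₁ , h₂ , h₃ , e) = α , β , h₁ , h₂ , h₃ , ≈ₚ.trans (≈ₚ.sym p≈q) e

      comb-cong : ∀ {α β u u′ v v′} → u ≈ₚ u′ → v ≈ₚ v′ → α · u +ₚ β · v ≈ₚ α · u′ +ₚ β · v′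
      comb-cong (e₁ , e₂) (e₃ , e₄) =
        +-cong (*-congˡ e₁) (*-congˡ e₃) , +-cong (*-congˡ e₂) (*-congˡ e₄)

      between-resp : ∀ {u u′ v v′ w} → u ≈ₚ u′ → v ≈ₚ v′ →
                     StrictlyBetween u v w → StrictlyBetween u′ v′ w
      between-resp e e′ (α , β , h₁ , h₂ , h₃ , h) =
        α , β , h₁ , h₂ , h₃ , ≈ₚ.trans h (comb-cong e e′)

      between-sym : ∀ {u v w} → StrictlyBetween u v w → StrictlyBetween v u w
      between-sym (α , β , h₁ , h₂ , h₃ , h) =
        β , α , h₂ , h₁ , ≈.trans (+-comm β α) h₃ , ≈ₚ.trans h (+-comm _ _ , +-comm _ _)

      edge-resp : ∀ {p p′ q q′} → p ≈ₚ p′ → q ≈ₚ q′ → IsEdge p q → IsEdge p′ q′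
      edge-resp e e′ (p≉q , (t , t∈T , s) , none) =
        (λ h → p≉q (≈ₚ.trans e (≈ₚ.trans h (≈ₚ.sym e′)))) ,
        (t , t∈T , Any.map (λ (h , h′) → on-resp e h , on-resp e′ h′) s) ,
        (λ w v b → none w v (between-resp (≈ₚ.sym e) (≈ₚ.sym e′) b))

      edge-sym : ∀ {p q} → IsEdge p q → IsEdge q p
      edge-sym (p≉q , (t , t∈T , s) , none) =
        (λ h → p≉q (≈ₚ.sym h)) ,
        (t , t∈T , Any.map (λ (h , h′) → h′ , h) s) ,
        (λ w v b → none w v (between-sym b))

    RP : Graph
    RP = record
      { vertices = On.setoid {B = ∃ IsVertex} pointSetoid proj₁
      ; Adjacent = λ (p , _) (q , _) → IsEdge p q
      ; resp     = (λ e → edge-resp ≈ₚ.refl e) , (λ e → edge-resp e ≈ₚ.refl)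
      ; irrefl   = λ p≈q (p≉q , _) → p≉q p≈q
      ; sym      = edge-sym
      }

{-# OPTIONS --safe #-}

-- In a patch ωⁿ(K) label every tile by its position among the five pieces of
-- its parent.  Two tiles that nearly touch lie on a common square lattice, in
-- one of 33 relative placements: this list is closed under substitution, a
-- finite computation, and local facts about labels are read off it.  Tilings
-- inherit these facts, since every finite set of tiles lies in a patch.
--
-- Squared distances between vertices lie in ℤ[1/5], so the parity of the
-- squared distance from a fixed vertex makes sense.  Edges have length 1, 2 or
-- √5, and parity changes along those of length 1 or √5.  Those of length 2 are
-- the undivided long legs, shared by the second and fourth pieces of a parent;
-- exactly one of their endpoints lies inside the parent.  Giving these interior
-- vertices, which are pairwise non-adjacent, the third colour, and all others
-- their parity, is a 3-colouring.  Fewer colours do not suffice because a tile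
-- with an undivided long leg is a triangle of the graph.
module Submission where

open import Defs
open import Level using (0ℓ)
open import Axiom.ExcludedMiddle using (ExcludedMiddle)
open import Relation.Unary using (Pred)

import Algebra.Properties.AbelianGroup as AbelianGroupProperties
import Algebra.Properties.Ring as RingProperties
import Algebra.Properties.Semiring.Mult.TCOptimised as Multiples
import Algebra.Solver.Ring as RingSolver
open import Algebra.Solver.Ring.AlmostCommutativeRing
  using (fromCommutativeRing; _-Raw-AlmostCommutative⟶_)
open import Data.Fin.Base using (Fin)
open import Data.Fin.Patterns
import Data.Fin.Properties as Fin
open import Data.Integer.Base as ℤ using (ℤ; +_; -[1+_]; _⊖_; +≤+)
open import Data.Integer.DivMod using (_%ℕ_; _/ℕ_; a≡a%ℕn+[a/ℕn]*n; n%ℕd<d)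
import Data.Integer.Properties as ℤ
open import Data.Integer.Tactic.RingSolver using (solve-∀)
open import Data.List.Base as List using (List; []; _∷_)
open import Data.List.Membership.Propositional using (_∈_; find; lose)
import Data.List.Membership.DecPropositional as DecMembership
open import Data.List.Relation.Unary.All as All using (All; []; _∷_)
import Data.List.Relation.Unary.All.Properties as All
open import Data.List.Relation.Unary.Any as Any using (Any; here; there)
import Data.List.Relation.Unary.Any.Properties as Any
open import Data.Maybe.Base using (Maybe; just; nothing)
open import Data.Nat.Base as ℕ using (ℕ; zero; suc; s≤s)
import Data.Nat.Properties as ℕ
open import Data.Product.Base using (_×_; _,_; proj₁; proj₂; ∃; ∃-syntax; Σ-syntax)
open import Data.Product.Properties using (≡-dec)
open import Data.Sum.Base using (_⊎_; inj₁; inj₂; [_,_]′)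
open import Function.Base using (_∘_)
open import Relation.Binary.Bundles using (Setoid)
open import Relation.Binary.Definitions using (DecidableEquality)
open import Relation.Binary.PropositionalEquality as ≡ using (_≡_; _≢_)
import Relation.Binary.Reasoning.Setoid as SetoidReasoning
open import Relation.Binary.Structures using (IsTotalOrder)
open import Relation.Nullary.Decidable
  using (Dec; yes; no; toWitness; map′; ¬?; _×-dec_; _⊎-dec_; _→-dec_)
open import Relation.Nullary.Negation using (¬_; contradiction)

-- A tile gets a label only inside a patch, and nothing shows that two patches label it alike. So
-- the colouring is defined from the geometry of `T` alone (`Reversed`, `Special`, `EvenDist`), and
-- labels enter only inside proofs: all tiles concerned are put into one finite set, a patch is
-- taken, and `Local` is read off there. Every tile to be compared must therefore be chosen before
-- any label is known.
--
-- A tile on the other side of a leg is found by covering a probe point beyond it. Such a tile is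
-- not known in advance to touch the first one, only to come within a quarter of a unit; hence the
-- finite computation concerns tiles at distance below 1/√5 rather than touching ones. Expansion
-- only increases distances, so parents of near tiles are near, which makes the induction on the
-- level run.
--
-- The parity does not depend on the patch because 5 is odd: the denominators 5ⁿ vary with the
-- patch, but clearing them never changes evenness.

module Lattice where
  open import Data.Integer.Base using (_+_; _-_; _*_; -_; _^_; _≤_; _<_; ∣_∣)
  open ≡ using (refl; sym; trans; cong)
  open import Data.Integer.Properties using (_≟_; _≤?_; _<?_; abs-*)
  open import Data.Fin.Properties using (all?)

  -- Integer model of tiles and the finite computation

  ℤ² : Set
  ℤ² = ℤ × ℤ

  infix 4 _≟²_ _≟ₚ_
  _≟²_ : DecidableEquality ℤ²
  _≟²_ = ≡-dec _≟_ _≟_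

  open DecMembership _≟²_ using (_∈?_)

  infixl 6 _+²_
  _+²_ : ℤ² → ℤ² → ℤ²
  (x , y) +² (x′ , y′) = x + x′ , y + y′

  infixl 7 _•_
  _•_ : ℤ² → ℤ² → ℤ
  (x , y) • (x′ , y′) = x * x′ + y * y′

  -- In the coordinates of a tile the right angle is at (0,0), the end of the
  -- short leg at (1,0) and the end of the long leg at (0,2).  A placement is an
  -- affine map, used as the position of one tile in the coordinates of another.
  record Placement : Set where
    constructor pose
    field
      origin e₁ e₂ : ℤ²

  open Placement

  linear : Placement → ℤ² → ℤ²
  linear ρ (x , y) = let (a , b) = e₁ ρ ; (c , d) = e₂ ρ in x * a + y * c , x * b + y * d

  infixr 8 _⟨_⟩
  _⟨_⟩ : Placement → ℤ² → ℤ²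
  ρ ⟨ p ⟩ = origin ρ +² linear ρ p

  infixr 9 _⊚_
  _⊚_ : Placement → Placement → Placement
  ρ ⊚ σ = pose (ρ ⟨ origin σ ⟩) (linear ρ (e₁ σ)) (linear ρ (e₂ σ))

  -- Conjugation by the homothety of ratio 5.
  expand : Placement → Placement
  expand (pose (x , y) u v) = pose (+ 5 * x , + 5 * y) u v

  _≟ₚ_ : DecidableEquality Placement
  pose o u v ≟ₚ pose o′ u′ v′ =
    map′ (λ { (refl , refl , refl) → refl }) (λ { refl → refl , refl , refl })
         (o ≟² o′ ×-dec u ≟² u′ ×-dec v ≟² v′)

  pattern -1ℤ = -[1+ 0 ]

  right° short° long° mid° : ℤ²
  right° = + 0 , + 0
  short° = + 1 , + 0
  long°  = + 0 , + 2
  mid°   = + 0 , + 1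

  corners° : List ℤ²
  corners° = right° ∷ short° ∷ long° ∷ []

  -- The pieces in the coordinates of the parent tile multiplied by 5; the point
  -- (x, y) of the dissection has the coordinates (2x - y, x + 2y).
  piece : Fin 5 → Placement
  piece 0F = pose (+ 4 , + 2) (+ 1 , - + 2) (- + 2 , - + 1)
  piece 1F = pose (+ 2 , + 1) (- + 2 , - + 1) (- + 1 , + 2)
  piece 2F = pose (+ 4 , + 2) (- + 2 , - + 1) (- + 1 , + 2)
  piece 3F = pose (+ 0 , + 5) (+ 2 , + 1) (+ 1 , - + 2)
  piece 4F = pose (+ 2 , + 6) (- + 2 , - + 1) (- + 1 , + 2)

  -- Quarter turns suffice: the linear parts of all `piece j` reverse orientation and differ from
  -- each other by quarter turns. Conjugating a quarter turn by one of them gives a quarter turn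
  -- again, so no other relative direction arises.
  turn : Fin 4 → ℤ² → Placement
  turn 0F o = pose o (+ 1 , + 0) (+ 0 , + 1)
  turn 1F o = pose o (+ 0 , + 1) (-1ℤ , + 0)
  turn 2F o = pose o (-1ℤ , + 0) (+ 0 , -1ℤ)
  turn 3F o = pose o (+ 0 , -1ℤ) (+ 1 , + 0)

  identity : Placement
  identity = turn 0F (+ 0 , + 0)

  -- Obtained by closing the identity under passing to pieces that are not Far
  -- from each other (see Step).
  neighbours : List Placement
  neighbours =
    identity ∷
    turn 0F (- + 1 , + 0) ∷ turn 0F (- + 1 , + 1) ∷ turn 0F (- + 1 , + 2) ∷ turn 0F (+ 0 , - + 2) ∷
    turn 0F (+ 0 , + 2) ∷ turn 0F (+ 1 , - + 2) ∷ turn 0F (+ 1 , - + 1) ∷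
    turn 0F (+ 1 , + 0) ∷
    turn 1F (+ 0 , - + 1) ∷ turn 1F (+ 0 , + 0) ∷ turn 1F (+ 0 , + 1) ∷ turn 1F (+ 0 , + 2) ∷
    turn 1F (+ 1 , - + 1) ∷ turn 1F (+ 1 , + 2) ∷ turn 1F (+ 2 , + 2) ∷ turn 1F (+ 3 , + 0) ∷
    turn 2F (+ 0 , + 0) ∷ turn 2F (+ 0 , + 1) ∷ turn 2F (+ 0 , + 2) ∷ turn 2F (+ 0 , + 3) ∷
    turn 2F (+ 0 , + 4) ∷ turn 2F (+ 1 , + 0) ∷ turn 2F (+ 1 , + 2) ∷ turn 2F (+ 2 , + 0) ∷
    turn 3F (- + 2 , + 0) ∷ turn 3F (- + 2 , + 1) ∷ turn 3F (- + 2 , + 2) ∷ turn 3F (- + 1 , + 0) ∷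
    turn 3F (+ 0 , + 0) ∷ turn 3F (+ 0 , + 3) ∷ turn 3F (+ 1 , + 0) ∷ turn 3F (+ 1 , + 1) ∷
    []

  -- Pythagorean vectors g with their lengths n.
  directions : List (ℤ² × ℤ)
  directions =
    ((+ 1 , + 0) , + 1) ∷ ((- + 1 , + 0) , + 1) ∷ ((+ 0 , + 1) , + 1) ∷ ((+ 0 , - + 1) , + 1) ∷
    ((+ 3 , + 4) , + 5) ∷ ((+ 3 , - + 4) , + 5) ∷ ((- + 4 , - + 3) , + 5) ∷ []

  opaque
    directions-normed : All (λ (g , n) → n * n ≡ g • g × ¬ (n ≡ + 0) × + 0 ≤ n) directions
    directions-normed = toWitness
      {a? = All.all? (λ (g , n) → n * n ≟ g • g ×-dec ¬? (n ≟ + 0) ×-dec + 0 ≤? n) directions} _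

  normals : List ℤ²
  normals =
    (+ 1 , + 0) ∷ (- + 1 , + 0) ∷ (+ 0 , + 1) ∷ (+ 0 , - + 1) ∷
    (+ 2 , + 1) ∷ (- + 2 , - + 1) ∷ (+ 1 , - + 2) ∷ (- + 1 , + 2) ∷ []

  -- The vector `g` has length `n`, so a gap of `n` in the values of `g` is a distance of at least
  -- 1. Pythagorean directions keep this certificate integral.
  Far : Placement → Placement → Set
  Far σ τ = Any
    (λ (g , n) → All (λ p → All (λ q → g • σ ⟨ p ⟩ + n ≤ g • τ ⟨ q ⟩) corners°) corners°)
    directions

  far? : ∀ σ τ → Dec (Far σ τ)
  far? σ τ = Any.any?
    (λ (g , n) → All.all? (λ p → All.all? (λ q → g • σ ⟨ p ⟩ + n ≤? g • τ ⟨ q ⟩) corners°) corners°)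
    directions

  -- The triangle K enlarged five times, in accordance with the scaling of `piece`.
  halfPlanes : List (ℤ² × ℤ)
  halfPlanes = ((+ 1 , + 0) , + 0) ∷ ((+ 0 , + 1) , + 0) ∷ ((- + 2 , - + 1) , - + 10) ∷ []

  opaque
    pieces-inside : ∀ j → All (λ (g , m) → All (λ q → m ≤ g • piece j ⟨ q ⟩) corners°) halfPlanes
    pieces-inside = toWitness
      {a? = all? λ j → All.all? (λ (g , m) → All.all? (λ q → m ≤? g • piece j ⟨ q ⟩) corners°) halfPlanes} _

  -- The point z is given in quarter units.
  Outside : ℤ² → Placement → Set
  Outside z ρ = Any (λ g → All (λ q → g • z < + 4 * (g • ρ ⟨ q ⟩)) corners°) normals

  outside? : ∀ z ρ → Dec (Outside z ρ)
  outside? z ρ = Any.any? (λ g → All.all? (λ q → g • z <? + 4 * (g • ρ ⟨ q ⟩)) corners°) normals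

  Reverses : Placement → Set
  Reverses ρ = ρ ⟨ right° ⟩ ≡ long° × ρ ⟨ long° ⟩ ≡ right°

  reverses? : ∀ ρ → Dec (Reverses ρ)
  reverses? ρ = (ρ ⟨ right° ⟩ ≟² long°) ×-dec (ρ ⟨ long° ⟩ ≟² right°)

  -- The second and fourth pieces share an undivided long leg.
  Paired : Fin 5 → Set
  Paired i = i ≡ 1F ⊎ i ≡ 3F

  paired? : ∀ i → Dec (Paired i)
  paired? i = (i Fin.≟ 1F) ⊎-dec (i Fin.≟ 3F)

  -- The interior vertex of the parent in the coordinates of its i-th piece; it
  -- does not lie on the last piece, for which the value is irrelevant.
  tip : Fin 5 → ℤ²
  tip 0F = mid°
  tip 1F = right°
  tip 2F = short°
  tip 3F = long°
  tip 4F = right°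

  dist²ℤ : ℤ² → ℤ² → ℤ
  dist²ℤ (x , y) (x′ , y′) = (x - x′) * (x - x′) + (y - y′) * (y - y′)

  InKℤ : ℤ → ℤ² → Set
  InKℤ k (x , y) = + 0 ≤ x × + 0 ≤ y × + 2 * x + y ≤ k

  inKℤ? : ∀ k z → Dec (InKℤ k z)
  inKℤ? k (x , y) = + 0 ≤? x ×-dec + 0 ≤? y ×-dec + 2 * x + y ≤? k

  Anchor : ℤ² → ℤ² → Set
  Anchor z a = dist²ℤ z a ≡ + 1 × InKℤ (+ 8) a

  anchor? : ∀ z a → Dec (Anchor z a)
  anchor? z a = dist²ℤ z a ≟ + 1 ×-dec inKℤ? (+ 8) a

  -- Probes are points just outside a tile, in quarter units: a tile of the tiling
  -- covering a probe is near enough for its placement to be among neighbours.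
  acrossMid acrossShort : ℤ²
  acrossMid   = - + 1 , + 4
  acrossShort = + 1 , - + 1

  -- Within a dissected parent these points lie in the second piece for `0F` and `1F` and in the
  -- fourth for the others; a piece that is already paired is probed in itself.
  pairedProbe : Fin 5 → ℤ²
  pairedProbe 0F = - + 1 , + 5
  pairedProbe 1F = + 1 , + 1
  pairedProbe 2F = + 3 , + 4
  pairedProbe 3F = + 1 , + 1
  pairedProbe 4F = + 2 , - + 1

  pairedAnchor : Fin 5 → ℤ²
  pairedAnchor 0F = + 0 , + 5
  pairedAnchor 1F = + 1 , + 0
  pairedAnchor 2F = + 2 , + 4
  pairedAnchor 3F = + 1 , + 0
  pairedAnchor 4F = + 2 , + 0

  opaque
    paired-anchored : ∀ i → Anchor (pairedProbe i) (pairedAnchor i)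
    paired-anchored = toWitness {a? = all? λ i → anchor? (pairedProbe i) (pairedAnchor i)} _

  latticePoints : List ℤ²
  latticePoints = mid° ∷ corners°

  -- Each side with a normal vector.
  sides° : List ((ℤ² × ℤ²) × ℤ²)
  sides° =
    ((right° , short°) , (+ 0 , + 1)) ∷ ((right° , long°) , (+ 1 , + 0)) ∷
    ((short° , long°) , (+ 2 , + 1)) ∷ []

  data Step° (z w : ℤ²) : Set where
    odd-1    : dist²ℤ z w ≡ + 1 → Step° z w
    odd-5    : dist²ℤ z w ≡ + 5 → Step° z w
    long-leg : z ≡ right° → w ≡ long° → Step° z w
    long-leg⁻ : z ≡ long° → w ≡ right° → Step° z w

  MidCorner : Placement → Set
  MidCorner ρ = Any (λ c → ρ ⟨ c ⟩ ≡ mid°) corners°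

  -- Each fact depends only on `i`, `j` and `ρ`, so the closure computation decides it along the
  -- way. `across-mid` and `paired-mid` tell divided from undivided long legs, `reverse-paired`
  -- gives the labels at an undivided one, `across-short` and `mid-right` tell `1F` from `3F`,
  -- `right-tip` locates the interior vertex in nearby tiles, and `probe-paired` leads to an
  -- undivided leg.
  record Local (i j : Fin 5) (ρ : Placement) : Set where
    constructor local
    field
      across-mid     : Outside acrossMid ρ ⊎ Reverses ρ ⊎ MidCorner ρ
      reverse-paired : Reverses ρ → (i ≡ 1F × j ≡ 3F) ⊎ (i ≡ 3F × j ≡ 1F)
      paired-mid     : Paired i → ¬ MidCorner ρ
      across-short   : i ≡ 1F → Outside acrossShort ρ ⊎ ρ ⟨ mid° ⟩ ≡ right°
      mid-right      : Paired i → ρ ⟨ mid° ⟩ ≡ right° → i ≡ 1F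
      right-tip      : j ≡ 1F → Any (ρ ⟨ right° ⟩ ≡_) latticePoints → ρ ⟨ right° ⟩ ≡ tip i
      probe-paired   : Outside (pairedProbe i) ρ ⊎ Paired j

  local? : ∀ i j ρ → Dec (Local i j ρ)
  local? i j ρ = map′
    (λ (a , b , c , d , e , f , g) → local a b c d e f g)
    (λ (local a b c d e f g) → a , b , c , d , e , f , g)
    ( (outside? acrossMid ρ ⊎-dec reverses? ρ ⊎-dec midCorner?)
    ×-dec (reverses? ρ →-dec ((i Fin.≟ 1F ×-dec j Fin.≟ 3F) ⊎-dec (i Fin.≟ 3F ×-dec j Fin.≟ 1F)))
    ×-dec (paired? i →-dec ¬? midCorner?)
    ×-dec (i Fin.≟ 1F →-dec (outside? acrossShort ρ ⊎-dec ρ ⟨ mid° ⟩ ≟² right°))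
    ×-dec (paired? i →-dec (ρ ⟨ mid° ⟩ ≟² right° →-dec i Fin.≟ 1F))
    ×-dec (j Fin.≟ 1F →-dec (Any.any? (ρ ⟨ right° ⟩ ≟²_) latticePoints →-dec ρ ⟨ right° ⟩ ≟² tip i))
    ×-dec (outside? (pairedProbe i) ρ ⊎-dec paired? j) )
    where
    midCorner? : Dec (MidCorner ρ)
    midCorner? = Any.any? (λ c → ρ ⟨ c ⟩ ≟² mid°) corners°

  opaque
    lattice-K : ∀ {z} → InKℤ (+ 2) z → Any (z ≡_) latticePoints
    lattice-K {+ 0 , + 0} _ = there (here refl)
    lattice-K {+ 0 , + 1} _ = here refl
    lattice-K {+ 0 , + 2} _ = there (there (there (here refl)))
    lattice-K {+ 0 , + (suc (suc (suc _)))} (_ , _ , +≤+ (s≤s (s≤s ())))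
    lattice-K {+ 1 , + 0} _ = there (there (here refl))
    lattice-K {+ 1 , + (suc _)} (_ , _ , +≤+ (s≤s (s≤s ())))
    lattice-K {+ (suc (suc x)) , + y} (_ , _ , +≤+ (s≤s (s≤s h)))
      with ℕ.m+n≡0⇒n≡0 x (ℕ.m+n≡0⇒m≡0 (x ℕ.+ suc (suc (x ℕ.+ 0))) (ℕ.n≤0⇒n≡0 h))
    ... | ()

  opaque
    side-corners : All (λ ((a , b) , g) → a ∈ corners° × b ∈ corners° × a ≢ b × g • a ≡ g • b) sides°
    side-corners = toWitness {a? = All.all? (λ ((a , b) , g) →
      (a ∈? corners°) ×-dec (b ∈? corners°) ×-dec ¬? (a ≟² b) ×-dec (g • a ≟ g • b)) sides°} _

  opaque
    side-step : All (λ ((a , b) , g) → All (λ z → All (λ w →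
                  g • z ≡ g • a → g • w ≡ g • a → z ≡ w ⊎ Step° z w)
                latticePoints) latticePoints) sides°
    side-step = toWitness {a? = All.all? (λ ((a , b) , g) → All.all? (λ z → All.all? (λ w →
        g • z ≟ g • a →-dec (g • w ≟ g • a →-dec ((z ≟² w) ⊎-dec step°? z w)))
      latticePoints) latticePoints) sides°} _
      where
      step°? : ∀ z w → Dec (Step° z w)
      step°? z w = map′
        [ odd-1 , [ odd-5 , [ (λ (p , q) → long-leg p q) , (λ (p , q) → long-leg⁻ p q) ]′ ]′ ]′
        (λ { (odd-1 p) → inj₁ p ; (odd-5 p) → inj₂ (inj₁ p)
           ; (long-leg p q) → inj₂ (inj₂ (inj₁ (p , q))) ; (long-leg⁻ p q) → inj₂ (inj₂ (inj₂ (p , q))) })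
        (dist²ℤ z w ≟ + 1 ⊎-dec dist²ℤ z w ≟ + 5 ⊎-dec
         (z ≟² right° ×-dec w ≟² long°) ⊎-dec (z ≟² long° ×-dec w ≟² right°))

  opaque
    side-between : All (λ ((a , b) , g) → All (λ z →
                     g • z ≡ g • a → z ≡ a ⊎ z ≡ b ⊎ (z ≡ mid° × a ≡ right° × b ≡ long°))
                   latticePoints) sides°
    side-between = toWitness {a? = All.all? (λ ((a , b) , g) → All.all? (λ z →
        g • z ≟ g • a →-dec
        ((z ≟² a) ⊎-dec (z ≟² b) ⊎-dec (z ≟² mid° ×-dec a ≟² right° ×-dec b ≟² long°)))
      latticePoints) sides°} _

  -- Both sides of the equation are read in the coordinates of the parent of piece `i`, enlarged
  -- five times. An equation of composites avoids inverting `piece i`, whose inverse is not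
  -- integral.
  Step : Placement → Set
  Step ρ = ∀ i j → Far (piece i) (expand ρ ⊚ piece j) ⊎
                   Any (λ ρ′ → expand ρ ⊚ piece j ≡ piece i ⊚ ρ′ × Local i j ρ′) neighbours

  step? : ∀ ρ → Dec (Step ρ)
  step? ρ = all? λ i → all? λ j → far? (piece i) (expand ρ ⊚ piece j) ⊎-dec
    Any.any? (λ ρ′ → (expand ρ ⊚ piece j ≟ₚ piece i ⊚ ρ′) ×-dec local? i j ρ′) neighbours

  opaque
    identity-local : Local 1F 1F identity
    identity-local = toWitness {a? = local? 1F 1F identity} _

    steps : All Step neighbours
    steps = toWitness {a? = All.all? step? neighbours} _

  -- Parity of integers

  Even Odd : ℤ → Set
  Even x = ∃[ k ] x ≡ + 2 * k
  Odd x = ∃[ k ] x ≡ + 1 + + 2 * k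

  opaque
    even⊎odd : ∀ x → Even x ⊎ Odd x
    even⊎odd x with x %ℕ 2 | n%ℕd<d x 2 | a≡a%ℕn+[a/ℕn]*n x 2
    ... | 0 | _ | eq = inj₁ (x /ℕ 2 , trans eq (lemma (x /ℕ 2)))
      where
      lemma : ∀ k → + 0 + k * + 2 ≡ + 2 * k
      lemma = solve-∀
    ... | 1 | _ | eq = inj₂ (x /ℕ 2 , trans eq (lemma (x /ℕ 2)))
      where
      lemma : ∀ k → + 1 + k * + 2 ≡ + 1 + + 2 * k
      lemma = solve-∀
    ... | suc (suc _) | s≤s (s≤s ()) | _

  opaque
    even⇒¬odd : ∀ {x} → Even x → ¬ Odd x
    even⇒¬odd {x} (k , e) (l , e′) =
      absurd (k - l) (trans (diff k l) (trans (cong (_- + 2 * l) (trans (sym e) e′)) (one l)))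
      where
      diff : ∀ k l → + 2 * (k - l) ≡ + 2 * k - + 2 * l
      diff = solve-∀
      one : ∀ l → + 1 + + 2 * l - + 2 * l ≡ + 1
      one = solve-∀
      absurd : ∀ k → ¬ (+ 2 * k ≡ + 1)
      absurd k e with ∣ k ∣ | trans (sym (abs-* (+ 2) k)) (cong ∣_∣ e)
      ... | zero  | ()
      ... | suc n | e′ with trans (sym (ℕ.+-suc n (n ℕ.+ 0))) (ℕ.suc-injective e′)
      ...   | ()

  opaque
    odd-* : ∀ {x y} → Odd x → Odd y → Odd (x * y)
    odd-* (k , refl) (l , refl) = k + l + + 2 * (k * l) , lemma k l
      where
      lemma : ∀ k l → (+ 1 + + 2 * k) * (+ 1 + + 2 * l) ≡ + 1 + + 2 * (k + l + + 2 * (k * l))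
      lemma = solve-∀

  even+even : ∀ {x y} → Even x → Even y → Even (x + y)
  even+even (k , refl) (l , refl) = k + l , lemma k l
    where
    lemma : ∀ k l → + 2 * k + + 2 * l ≡ + 2 * (k + l)
    lemma = solve-∀

  odd+odd : ∀ {x y} → Odd x → Odd y → Even (x + y)
  odd+odd (k , refl) (l , refl) = + 1 + k + l , lemma k l
    where
    lemma : ∀ k l → (+ 1 + + 2 * k) + (+ 1 + + 2 * l) ≡ + 2 * (+ 1 + k + l)
    lemma = solve-∀

  even+odd : ∀ {x y} → Even x → Odd y → Odd (x + y)
  even+odd (k , refl) (l , refl) = k + l , lemma k l
    where
    lemma : ∀ k l → + 2 * k + (+ 1 + + 2 * l) ≡ + 1 + + 2 * (k + l)
    lemma = solve-∀

  odd-5^ : ∀ n → Odd ((+ 5) ^ n)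
  odd-5^ zero    = + 0 , refl
  odd-5^ (suc n) = odd-* {+ 5} (+ 2 , refl) (odd-5^ n)

  -- The three difference vectors add up to zero.
  opaque
    even-perimeter : ∀ a b c → Even (dist²ℤ a b + dist²ℤ a c + dist²ℤ b c)
    even-perimeter (a , a′) (b , b′) (c , c′) = _ , lemma a a′ b b′ c c′
      where
      lemma : ∀ a a′ b b′ c c′ →
        ((a - b) * (a - b) + (a′ - b′) * (a′ - b′)) + ((a - c) * (a - c) + (a′ - c′) * (a′ - c′)) +
        ((b - c) * (b - c) + (b′ - c′) * (b′ - c′)) ≡
        + 2 * ((a - b) * (a - c) + (b - c) * (b - c) + ((a′ - b′) * (a′ - c′) + (b′ - c′) * (b′ - c′)))
      lemma = solve-∀

open Lattice

-- Choice and comparison of three colours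

pick : ∀ {A B : Set} → Dec A → Dec B → Fin 3
pick (yes _) _       = 2F
pick (no _)  (yes _) = 0F
pick (no _)  (no _)  = 1F

pick-cong : ∀ {A B A′ B′ : Set} (a : Dec A) (b : Dec B) (a′ : Dec A′) (b′ : Dec B′) →
            (A → A′) → (A′ → A) → (B → B′) → (B′ → B) → pick a b ≡ pick a′ b′
pick-cong (yes a) _       (yes a′) _        f f′ g g′ = ≡.refl
pick-cong (yes a) _       (no ¬a′) _        f f′ g g′ = contradiction (f a) ¬a′
pick-cong (no ¬a) _       (yes a′) _        f f′ g g′ = contradiction (f′ a′) ¬a
pick-cong (no _)  (yes _) (no _)   (yes _)  f f′ g g′ = ≡.refl
pick-cong (no _)  (yes b) (no _)   (no ¬b′) f f′ g g′ = contradiction (g b) ¬b′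
pick-cong (no _)  (no ¬b) (no _)   (yes b′) f f′ g g′ = contradiction (g′ b′) ¬b
pick-cong (no _)  (no _)  (no _)   (no _)   f f′ g g′ = ≡.refl

-- The second disjunct says that the parities differ, in a negative form that can be proved without
-- deciding them. The first covers the edges of length 2, along which the parities agree.
pick-≢ : ∀ {A B A′ B′ : Set} (a : Dec A) (b : Dec B) (a′ : Dec A′) (b′ : Dec B′) →
         ¬ (A × A′) → (A ⊎ A′) ⊎ (¬ (B × B′) × ¬ (¬ B × ¬ B′)) → pick a b ≢ pick a′ b′
pick-≢ (yes a) _       (yes a′) _        h _ _ = h (a , a′)
pick-≢ (yes a) _       (no _)   (yes _)  _ _ ()
pick-≢ (yes a) _       (no _)   (no _)   _ _ ()
pick-≢ (no _)  (yes _) (yes _)  _        _ _ ()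
pick-≢ (no _)  (no _)  (yes _)  _        _ _ ()
pick-≢ (no ¬a) _       (no ¬a′) _        _ (inj₁ (inj₁ a)) _ = ¬a a
pick-≢ (no ¬a) _       (no ¬a′) _        _ (inj₁ (inj₂ a′)) _ = ¬a′ a′
pick-≢ (no _)  (yes b) (no _)   (yes b′) _ (inj₂ (h , _)) _ = h (b , b′)
pick-≢ (no _)  (no ¬b) (no _)   (no ¬b′) _ (inj₂ (_ , h)) _ = h (¬b , ¬b′)
pick-≢ (no _)  (yes b) (no _)   (no ¬b′) _ (inj₂ _) ()
pick-≢ (no _)  (no ¬b) (no _)   (yes b′) _ (inj₂ _) ()

three-distinct : ∀ {m} (i j k : Fin m) → i ≢ j → j ≢ k → i ≢ k → 3 ℕ.≤ m
three-distinct i j k i≢j j≢k i≢k = Fin.injective⇒≤ {f = f} injective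
  where
  f : Fin 3 → Fin _
  f 0F = i
  f 1F = j
  f 2F = k
  injective : ∀ {x y} → f x ≡ f y → x ≡ y
  injective {0F} {0F} _ = ≡.refl
  injective {0F} {1F} e = contradiction e i≢j
  injective {0F} {2F} e = contradiction e i≢k
  injective {1F} {0F} e = contradiction (≡.sym e) i≢j
  injective {1F} {1F} _ = ≡.refl
  injective {1F} {2F} e = contradiction e j≢k
  injective {2F} {0F} e = contradiction (≡.sym e) i≢k
  injective {2F} {1F} e = contradiction (≡.sym e) j≢k
  injective {2F} {2F} _ = ≡.refl

-- Arithmetic of the ordered field and the embedded integers

module OrderedField (em : ExcludedMiddle 0ℓ) (ℝ : CompleteOrderedField) where
  open CompleteOrderedField ℝ
  open IsTotalOrder isTotalOrder public
    using ()
    renaming (refl to ≤-refl; trans to ≤-trans; antisym to ≤-antisym;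
              total to ≤-total; reflexive to ≤-reflexive)
  open SetoidReasoning setoid
  open Multiples semiring using (1+×; ×-homo-+; ×1-homo-*) renaming (_×_ to _⊗_)
  open AbelianGroupProperties +-abelianGroup using () renaming (⁻¹-∙-comm to -‿+-comm)
  open RingProperties ring
    using (-‿distribˡ-*; -‿distribʳ-*; -0#≈0#; -‿involutive)

  -- Serves as the coefficient morphism of the ring solver, so that numerals are normalised as
  -- integers instead of being treated as atoms.
  ι : ℤ → Carrier
  ι (+ n)    = n ⊗ 1#
  ι -[1+ n ] = - (suc n ⊗ 1#)

  ι-⊖ : ∀ m n → ι (m ⊖ n) ≈ m ⊗ 1# - n ⊗ 1#
  ι-⊖ m       zero    = sym (trans (+-congˡ -0#≈0#) (+-identityʳ _))
  ι-⊖ zero    (suc n) = sym (+-identityˡ _)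
  ι-⊖ (suc m) (suc n) = begin
    ι (suc m ⊖ suc n)                ≡⟨ ≡.cong ι (ℤ.[1+m]⊖[1+n]≡m⊖n m n) ⟩
    ι (m ⊖ n)                        ≈⟨ ι-⊖ m n ⟩
    a - b                            ≈⟨ +-congʳ (+-identityˡ a) ⟨
    (0# + a) - b                     ≈⟨ +-congʳ (+-congʳ (-‿inverseʳ 1#)) ⟨
    ((1# - 1#) + a) - b              ≈⟨ +-congʳ (+-assoc 1# (- 1#) a) ⟩
    (1# + (- 1# + a)) - b            ≈⟨ +-congʳ (+-congˡ (+-comm (- 1#) a)) ⟩
    (1# + (a - 1#)) - b              ≈⟨ +-congʳ (+-assoc 1# a (- 1#)) ⟨
    ((1# + a) - 1#) - b              ≈⟨ +-assoc (1# + a) (- 1#) (- b) ⟩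
    (1# + a) + (- 1# - b)            ≈⟨ +-congˡ (-‿+-comm 1# b) ⟩
    (1# + a) - (1# + b)              ≈⟨ +-cong (1+× m 1#) (-‿cong (1+× n 1#)) ⟨
    suc m ⊗ 1# - suc n ⊗ 1#          ∎
    where
    a = m ⊗ 1#
    b = n ⊗ 1#

  ι-+ : ∀ i j → ι (i ℤ.+ j) ≈ ι i + ι j
  ι-+ (+ m)    (+ n)    = ×-homo-+ 1# m n
  ι-+ (+ m)    -[1+ n ] = ι-⊖ m (suc n)
  ι-+ -[1+ m ] (+ n)    = trans (ι-⊖ n (suc m)) (+-comm _ _)
  ι-+ -[1+ m ] -[1+ n ] = begin
    - ((2 ℕ.+ (m ℕ.+ n)) ⊗ 1#)       ≡⟨ ≡.cong (λ k → - (suc k ⊗ 1#)) (≡.sym (ℕ.+-suc m n)) ⟩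
    - ((suc m ℕ.+ suc n) ⊗ 1#)       ≈⟨ -‿cong (×-homo-+ 1# (suc m) (suc n)) ⟩
    - (suc m ⊗ 1# + suc n ⊗ 1#)      ≈⟨ -‿+-comm _ _ ⟨
    - (suc m ⊗ 1#) - (suc n ⊗ 1#)    ∎

  ι-neg : ∀ i → ι (ℤ.- i) ≈ - ι i
  ι-neg (+ zero)  = sym -0#≈0#
  ι-neg (+ suc n) = refl
  ι-neg -[1+ n ]  = sym (-‿involutive _)

  ι-*⁺ : ∀ m j → ι (+ m ℤ.* j) ≈ ι (+ m) * ι j
  ι-*⁺ m (+ n)    = trans (reflexive (≡.cong ι (≡.sym (ℤ.pos-* m n)))) (×1-homo-* m n)
  ι-*⁺ m -[1+ n ] = begin
    ι (+ m ℤ.* (ℤ.- + suc n))  ≡⟨ ≡.cong ι (ℤ.neg-distribʳ-* (+ m) (+ suc n)) ⟨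
    ι (ℤ.- (+ m ℤ.* + suc n))  ≈⟨ ι-neg (+ m ℤ.* + suc n) ⟩
    - ι (+ m ℤ.* + suc n)      ≈⟨ -‿cong (ι-*⁺ m (+ suc n)) ⟩
    - (ι (+ m) * ι (+ suc n))  ≈⟨ -‿distribʳ-* _ _ ⟩
    ι (+ m) * ι -[1+ n ]       ∎

  ι-* : ∀ i j → ι (i ℤ.* j) ≈ ι i * ι j
  ι-* (+ m)    j = ι-*⁺ m j
  ι-* -[1+ m ] j = begin
    ι ((ℤ.- + suc m) ℤ.* j)    ≡⟨ ≡.cong ι (ℤ.neg-distribˡ-* (+ suc m) j) ⟨
    ι (ℤ.- (+ suc m ℤ.* j))    ≈⟨ ι-neg (+ suc m ℤ.* j) ⟩
    - ι (+ suc m ℤ.* j)        ≈⟨ -‿cong (ι-*⁺ (suc m) j) ⟩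
    - (ι (+ suc m) * ι j)      ≈⟨ -‿distribˡ-* _ _ ⟩
    ι -[1+ m ] * ι j           ∎

  private
    ι-morphism : ℤ.+-*-rawRing -Raw-AlmostCommutative⟶ fromCommutativeRing commutativeRing
    ι-morphism = record
      { ⟦_⟧ = ι ; +-homo = ι-+ ; *-homo = ι-* ; -‿homo = ι-neg ; 0-homo = refl ; 1-homo = refl }

    ι-≟ : ∀ i j → Maybe (ι i ≈ ι j)
    ι-≟ i j with i ℤ.≟ j
    ... | yes eq = just (reflexive (≡.cong ι eq))
    ... | no _   = nothing

  open RingSolver ℤ.+-*-rawRing (fromCommutativeRing commutativeRing) ι-morphism ι-≟ public
    using (Polynomial; solve; con; _:=_; _:+_; _:*_; _:-_; :-_)

  x-y≈0⇒x≈y : ∀ {x y} → x - y ≈ 0# → x ≈ y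
  x-y≈0⇒x≈y {x} {y} e = begin
    x             ≈⟨ solve 2 (λ x y → x := (x :- y) :+ y) refl x y ⟩
    (x - y) + y   ≈⟨ +-congʳ e ⟩
    0# + y        ≈⟨ +-identityˡ y ⟩
    y             ∎

  ≤-resp : ∀ {x x′ y y′} → x ≈ x′ → y ≈ y′ → x ≤ y → x′ ≤ y′
  ≤-resp e e′ h = ≤-trans (≤-reflexive (sym e)) (≤-trans h (≤-reflexive e′))

  0≤-resp : ∀ {x y} → x ≈ y → 0# ≤ x → 0# ≤ y
  0≤-resp = ≤-resp refl

  x≤y⇒0≤y-x : ∀ {x y} → x ≤ y → 0# ≤ y - x
  x≤y⇒0≤y-x {x} {y} h = ≤-resp (-‿inverseʳ x) refl (+-monoˡ-≤ (- x) h)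

  0≤y-x⇒x≤y : ∀ {x y} → 0# ≤ y - x → x ≤ y
  0≤y-x⇒x≤y {x} {y} h =
    ≤-resp (+-identityˡ x) (solve 2 (λ x y → (y :- x) :+ x := y) refl x y) (+-monoˡ-≤ x h)

  0≤+ : ∀ {x y} → 0# ≤ x → 0# ≤ y → 0# ≤ x + y
  0≤+ {x} {y} h h′ = ≤-trans h′ (≤-resp (+-identityˡ y) refl (+-monoˡ-≤ y h))

  0≤x² : ∀ x → 0# ≤ x * x
  0≤x² x = [ (λ h → *-nonneg h h)
           , (λ h → let h′ = 0≤-resp (+-identityˡ (- x)) (x≤y⇒0≤y-x h) in
               0≤-resp (solve 1 (λ x → (:- x) :* (:- x) := x :* x) refl x) (*-nonneg h′ h′)) ]′
           (≤-total 0# x)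

  0≤1 : 0# ≤ 1#
  0≤1 = 0≤-resp (*-identityˡ 1#) (0≤x² 1#)

  0≤-+-zeroˡ : ∀ {x y} → 0# ≤ x → 0# ≤ y → x + y ≈ 0# → x ≈ 0#
  0≤-+-zeroˡ {x} {y} h h′ e =
    ≤-antisym (≤-resp (+-identityˡ x) (trans (+-comm y x) e) (+-monoˡ-≤ x h′)) h

  *-zero⇒ : ∀ {x y} → ¬ (x ≈ 0#) → x * y ≈ 0# → y ≈ 0#
  *-zero⇒ {x} {y} x≉0 e = begin
    y               ≈⟨ *-identityˡ y ⟨
    1# * y          ≈⟨ *-congʳ (⁻¹-inverse x≉0) ⟨
    (x * x ⁻¹) * y  ≈⟨ solve 3 (λ x i y → (x :* i) :* y := i :* (x :* y)) refl x (x ⁻¹) y ⟩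
    x ⁻¹ * (x * y)  ≈⟨ *-congˡ e ⟩
    x ⁻¹ * 0#       ≈⟨ zeroʳ _ ⟩
    0#              ∎

  x²≈0⇒x≈0 : ∀ {x} → x * x ≈ 0# → x ≈ 0#
  x²≈0⇒x≈0 {x} e with em {x ≈ 0#}
  ... | yes x≈0 = x≈0
  ... | no  x≉0 = *-zero⇒ x≉0 e

  0≤ι+ : ∀ n → 0# ≤ ι (+ n)
  0≤ι+ zero    = ≤-refl
  0≤ι+ (suc n) = 0≤-resp (sym (1+× n 1#)) (0≤+ 0≤1 (0≤ι+ n))

  ι-- : ∀ i j → ι (i ℤ.- j) ≈ ι i - ι j
  ι-- i j = trans (ι-+ i (ℤ.- j)) (+-congˡ (ι-neg j))

  ι-mono-≤ : ∀ {i j} → i ℤ.≤ j → ι i ≤ ι j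
  ι-mono-≤ {i} {j} i≤j = 0≤y-x⇒x≤y (0≤-resp (ι-- j i) (nonneg (ℤ.i≤j⇒0≤j-i i≤j)))
    where
    nonneg : ∀ {k} → ℤ.0ℤ ℤ.≤ k → 0# ≤ ι k
    nonneg {+ n} _ = 0≤ι+ n

  -- If `j` were smaller than `i`, then 1 + `ι j` ≤ `ι i` ≤ `ι j`, that is, 1 ≤ 0.
  ι-cancel-≤ : ∀ {i j} → ι i ≤ ι j → i ℤ.≤ j
  ι-cancel-≤ {i} {j} h = ℤ.≮⇒≥ λ j<i → 1≉0 (≤-antisym
    (≤-resp (solve 1 (λ x → (con (+ 1) :+ x) :- x := con (+ 1)) refl (ι j)) (-‿inverseʳ (ι j))
      (+-monoˡ-≤ (- ι j) (≤-trans (≤-resp (ι-+ (+ 1) j) refl (ι-mono-≤ (ℤ.i<j⇒suc[i]≤j j<i))) h)))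
    0≤1)

  ι-injective : ∀ {i j} → ι i ≈ ι j → i ≡ j
  ι-injective e = ℤ.≤-antisym (ι-cancel-≤ (≤-reflexive e)) (ι-cancel-≤ (≤-reflexive (sym e)))

  five : ∀ {n} → Polynomial n
  five = ((con (+ 2) :+ con (+ 2)) :+ con (+ 1))

  5≈ι5 : 5# ≈ ι (+ 5)
  5≈ι5 = solve 0 (five := con (+ 5)) refl

  10≈ι10 : 10# ≈ ι (+ 10)
  10≈ι10 = solve 0 (five :+ five := con (+ 10)) refl

  5≉0 : ¬ (5# ≈ 0#)
  5≉0 e with ι-injective {+ 5} {+ 0} (trans (sym 5≈ι5) e)
  ... | ()

  10≉0 : ¬ (10# ≈ 0#)
  10≉0 e with ι-injective {+ 10} {+ 0} (trans (sym 10≈ι10) e)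
  ... | ()

  -- The definition of `place` involves the inverses of 5 and 10 only. With the half defined as
  -- 5/10, the inverse of 10 becomes `½ * ⅕`.
  ½ ⅕ : Carrier
  ½ = 5# * 10# ⁻¹
  ⅕ = 5# ⁻¹

  5*⅕ : ι (+ 5) * ⅕ ≈ 1#
  5*⅕ = trans (*-congʳ (sym 5≈ι5)) (⁻¹-inverse 5≉0)

  ½+½ : ½ + ½ ≈ 1#
  ½+½ = begin
    5# * 10# ⁻¹ + 5# * 10# ⁻¹  ≈⟨ distribʳ (10# ⁻¹) 5# 5# ⟨
    10# * 10# ⁻¹               ≈⟨ ⁻¹-inverse 10≉0 ⟩
    1#                         ∎

  10⁻¹≈½*⅕ : 10# ⁻¹ ≈ ½ * ⅕
  10⁻¹≈½*⅕ = begin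
    10# ⁻¹                   ≈⟨ *-identityˡ _ ⟨
    1# * 10# ⁻¹              ≈⟨ *-congʳ (⁻¹-inverse 5≉0) ⟨
    (5# * ⅕) * 10# ⁻¹        ≈⟨ solve 3 (λ f g t → (f :* g) :* t := (f :* t) :* g) refl 5# ⅕ (10# ⁻¹) ⟩
    ½ * ⅕                    ∎

-- Tile coordinates and isometries

module Geometry (em : ExcludedMiddle 0ℓ) (ℝ : CompleteOrderedField) where
  open CompleteOrderedField ℝ
  open OrderedField em ℝ
  open Plane ℝ
  private
    module ≈ₚ = Setoid pointSetoid
    module ≈-Reasoning = SetoidReasoning setoid
    module ≈ₚ-Reasoning = SetoidReasoning pointSetoid

  two : ∀ {n} → Polynomial n
  two = con (+ 2)

  bary : Carrier → Carrier → Carrier → Carrier → Carrier → Carrier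
  bary a b c x k = a + x * (b - a) + k * (c - a)

  baryP : ∀ {n} → (a b c x k : Polynomial n) → Polynomial n
  baryP a b c x k = a :+ x :* (b :- a) :+ k :* (c :- a)

  -- The affine map from K to the triangle; the half is there because the long leg of K has length
  -- 2.
  at : Triangle → Point → Point
  at (△ a b c) (x , y) = a +ₚ x · (b -ₚ a) +ₚ (y * ½) · (c -ₚ a)

  bary-cong : ∀ {a a′ b b′ c c′ x x′ k k′} → a ≈ a′ → b ≈ b′ → c ≈ c′ → x ≈ x′ → k ≈ k′ →
              bary a b c x k ≈ bary a′ b′ c′ x′ k′
  bary-cong a b c x k =
    +-cong (+-cong a (*-cong x (+-cong b (-‿cong a)))) (*-cong k (+-cong c (-‿cong a)))

  at-cong : ∀ {t u p q} → t ≈△ u → p ≈ₚ q → at t p ≈ₚ at u q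
  at-cong ((a , a′) , (b , b′) , (c , c′)) (x , y) =
    bary-cong a b c x (*-congʳ y) , bary-cong a′ b′ c′ x (*-congʳ y)

  ≈△-refl : ∀ {t} → t ≈△ t
  ≈△-refl = ≈ₚ.refl , ≈ₚ.refl , ≈ₚ.refl

  at-congʳ : ∀ t {p q} → p ≈ₚ q → at t p ≈ₚ at t q
  at-congʳ t = at-cong {t} ≈△-refl

  ·-cong : ∀ {k k′ p q} → k ≈ k′ → p ≈ₚ q → k · p ≈ₚ k′ · q
  ·-cong k (x , y) = *-cong k x , *-cong k y

  ·-congˡ : ∀ {k p q} → p ≈ₚ q → k · p ≈ₚ k · q
  ·-congˡ = ·-cong refl

  halve : ∀ y → y ≈ y * ½ + y * ½
  halve y = trans (sym (trans (*-congˡ ½+½) (*-identityʳ y))) (distribˡ y ½ ½)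

  dist²-cong : ∀ {p p′ q q′} → p ≈ₚ p′ → q ≈ₚ q′ → dist² p q ≈ dist² p′ q′
  dist²-cong (x , y) (x′ , y′) = +-cong (*-cong dx dx) (*-cong dy dy)
    where
    dx = +-cong x (-‿cong x′)
    dy = +-cong y (-‿cong y′)

  dist²-· : ∀ k p q → dist² (k · p) (k · q) ≈ (k * k) * dist² p q
  dist²-· k (x , y) (x′ , y′) = solve 5
    (λ k x y x′ y′ →
      (k :* x :- k :* x′) :* (k :* x :- k :* x′) :+ (k :* y :- k :* y′) :* (k :* y :- k :* y′) :=
      (k :* k) :* ((x :- x′) :* (x :- x′) :+ (y :- y′) :* (y :- y′)))
    refl k x y x′ y′

  0≤dist² : ∀ p q → 0# ≤ dist² p q
  0≤dist² p q = 0≤+ (0≤x² _) (0≤x² _)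

  dist²≈0⇒≈ₚ : ∀ {p q} → dist² p q ≈ 0# → p ≈ₚ q
  dist²≈0⇒≈ₚ e =
    x-y≈0⇒x≈y (x²≈0⇒x≈0 (0≤-+-zeroˡ (0≤x² _) (0≤x² _) e)) ,
    x-y≈0⇒x≈y (x²≈0⇒x≈0 (0≤-+-zeroˡ (0≤x² _) (0≤x² _) (trans (+-comm _ _) e)))

  ≈ₚ⇒dist²≈0 : ∀ {p q} → p ≈ₚ q → dist² p q ≈ 0#
  ≈ₚ⇒dist²≈0 {p} {x , y} e = trans (dist²-cong e ≈ₚ.refl)
    (solve 2 (λ x y → (x :- x) :* (x :- x) :+ (y :- y) :* (y :- y) := con (+ 0)) refl x y)

  isometry-injective : ∀ {f} → IsIsometry f → ∀ {p q} → f p ≈ₚ f q → p ≈ₚ q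
  isometry-injective iso e = dist²≈0⇒≈ₚ (trans (sym (iso _ _)) (≈ₚ⇒dist²≈0 e))

  isometry-cong : ∀ {f} → IsIsometry f → ∀ {p q} → p ≈ₚ q → f p ≈ₚ f q
  isometry-cong iso e = dist²≈0⇒≈ₚ (trans (iso _ _) (≈ₚ⇒dist²≈0 e))

  isometry-resp : ∀ {f g} → IsIsometry f → (∀ p → g p ≈ₚ f p) → IsIsometry g
  isometry-resp iso e p q = trans (dist²-cong (e p) (e q)) (iso p q)

  -- One coordinate of Stewart's theorem for a barycentric combination.
  stewart : ∀ p a b c x k →
    (p - bary a b c x k) * (p - bary a b c x k) ≈
    (1# - x - k) * ((p - a) * (p - a)) + x * ((p - b) * (p - b)) + k * ((p - c) * (p - c)) -
    ((1# - x - k) * x * ((a - b) * (a - b)) + (1# - x - k) * k * ((a - c) * (a - c)) +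
     x * k * ((b - c) * (b - c)))
  stewart = solve 6 (λ p a b c x k →
    let q = p :- baryP a b c x k
        w = con (+ 1) :- x :- k
    in q :* q :=
       w :* ((p :- a) :* (p :- a)) :+ x :* ((p :- b) :* (p :- b)) :+ k :* ((p :- c) :* (p :- c)) :-
       (w :* x :* ((a :- b) :* (a :- b)) :+ w :* k :* ((a :- c) :* (a :- c)) :+
        x :* k :* ((b :- c) :* (b :- c)))) refl

  opaque
    -- By `stewart`, the squared distance from `f p` to the proposed image is a combination of six
    -- squared distances, all between images under `f`. They may be replaced by the distances
    -- between the original points, for which the combination vanishes.
    isometry-affine : ∀ {f} → IsIsometry f → ∀ p → f p ≈ₚ at (mapTriangle f K) p
    isometry-affine {f} iso p@(x , y) = dist²≈0⇒≈ₚ (begin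
      dist² (f p) (at (mapTriangle f K) p)
        ≈⟨ +-cong (stewart _ _ _ _ _ _) (stewart _ _ _ _ _ _) ⟩
      _
        ≈⟨ solve 14 (λ x k a b c d e g a′ b′ c′ d′ e′ g′ →
             let w = con (+ 1) :- x :- k in
             (w :* a :+ x :* b :+ k :* c :- (w :* x :* d :+ w :* k :* e :+ x :* k :* g)) :+
             (w :* a′ :+ x :* b′ :+ k :* c′ :- (w :* x :* d′ :+ w :* k :* e′ :+ x :* k :* g′)) :=
             w :* (a :+ a′) :+ x :* (b :+ b′) :+ k :* (c :+ c′) :-
             (w :* x :* (d :+ d′) :+ w :* k :* (e :+ e′) :+ x :* k :* (g :+ g′)))
             refl x k _ _ _ _ _ _ _ _ _ _ _ _ ⟩
      combine (dist² (f p) (f right₀)) (dist² (f p) (f short₀)) (dist² (f p) (f long₀))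
              (dist² (f right₀) (f short₀)) (dist² (f right₀) (f long₀)) (dist² (f short₀) (f long₀))
        ≈⟨ combine-cong (iso _ _) (iso _ _) (iso _ _) (iso _ _) (iso _ _) (iso _ _) ⟩
      combine (dist² p right₀) (dist² p short₀) (dist² p long₀)
              (dist² right₀ short₀) (dist² right₀ long₀) (dist² short₀ long₀)
        ≈⟨ combine-cong (q-cong right₀) (q-cong short₀) (q-cong long₀) refl refl refl ⟩
      combine (dist² q right₀) (dist² q short₀) (dist² q long₀)
              (dist² right₀ short₀) (dist² right₀ long₀) (dist² short₀ long₀)
        ≈⟨ solve 2 (λ x k →
             let w = con (+ 1) :- x :- k
                 y = k :+ k
                 O = con (+ 0)
                 I = con (+ 1)
                 T = con (+ 2)
                 d = λ a b c e → (a :- c) :* (a :- c) :+ (b :- e) :* (b :- e)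
             in
             w :* d x y O O :+ x :* d x y I O :+ k :* d x y O T :-
             (w :* x :* d O O I O :+ w :* k :* d O O O T :+ x :* k :* d I O O T) := O) refl x k ⟩
      0# ∎)
      where
      open ≈-Reasoning
      right₀ short₀ long₀ q : Point
      right₀ = right K
      short₀ = short K
      long₀  = long K
      k w : Carrier
      k = y * ½
      w = 1# - x - k
      -- With `y` written as `k + k` the final identity is polynomial in `x` and `k`, free of `½`.
      q = x , k + k
      combine : (a b c d e g : Carrier) → Carrier
      combine a b c d e g = w * a + x * b + k * c - (w * x * d + w * k * e + x * k * g)
      combine-cong : ∀ {a a′ b b′ c c′ d d′ e e′ g g′} → a ≈ a′ → b ≈ b′ → c ≈ c′ → d ≈ d′ → e ≈ e′ → g ≈ g′ →
                     combine a b c d e g ≈ combine a′ b′ c′ d′ e′ g′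
      combine-cong a b c d e g =
        +-cong (+-cong (+-cong (*-congˡ a) (*-congˡ b)) (*-congˡ c))
               (-‿cong (+-cong (+-cong (*-congˡ d) (*-congˡ e)) (*-congˡ g)))
      q-cong : ∀ u → dist² p u ≈ dist² q u
      q-cong u = dist²-cong {p = p} {p′ = q} {q = u} (refl , halve y) ≈ₚ.refl

  opaque
    tile-isometry : ∀ {t} → IsTile t → IsIsometry (at t)
    tile-isometry {t} (f , iso , t≈fK) = isometry-resp {f} {at t} iso
      λ p → ≈ₚ.trans (at-cong {t} t≈fK ≈ₚ.refl) (≈ₚ.sym (isometry-affine iso p))

  -- Integral placements as affine maps of the plane

  ιₚ : ℤ² → Point
  ιₚ (x , y) = ι x , ι y

  ⟪_⟫ : Placement → Point → Point
  ⟪ pose o u v ⟫ (x , y) = ιₚ o +ₚ x · ιₚ u +ₚ y · ιₚ v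

  ⟪⟫-cong : ∀ ρ {p q} → p ≈ₚ q → ⟪ ρ ⟫ p ≈ₚ ⟪ ρ ⟫ q
  ⟪⟫-cong ρ (x , y) = lin x y , lin x y
    where
    lin : ∀ {a b c x x′ y y′} → x ≈ x′ → y ≈ y′ → a + x * b + y * c ≈ a + x′ * b + y′ * c
    lin x y = +-cong (+-congˡ (*-congʳ x)) (*-congʳ y)

  private
    ι-lin : ∀ x y a c → ι (x ℤ.* a ℤ.+ y ℤ.* c) ≈ ι x * ι a + ι y * ι c
    ι-lin x y a c = trans (ι-+ (x ℤ.* a) (y ℤ.* c)) (+-cong (ι-* x a) (ι-* y c))

    ι-aff : ∀ o x y a c → ι (o ℤ.+ (x ℤ.* a ℤ.+ y ℤ.* c)) ≈ ι o + ι x * ι a + ι y * ι c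
    ι-aff o x y a c = trans (trans (ι-+ o _) (+-congˡ (ι-lin x y a c))) (sym (+-assoc _ _ _))

  ⟪⟫-ιₚ : ∀ ρ z → ⟪ ρ ⟫ (ιₚ z) ≈ₚ ιₚ (ρ ⟨ z ⟩)
  ⟪⟫-ιₚ (pose (o , o′) (a , b) (c , d)) (x , y) = sym (ι-aff o x y a c) , sym (ι-aff o′ x y b d)

  ⟪⟫-⊚ : ∀ ρ σ p → ⟪ ρ ⊚ σ ⟫ p ≈ₚ ⟪ ρ ⟫ (⟪ σ ⟫ p)
  ⟪⟫-⊚ (pose (o , o′) (a , b) (c , d)) (pose (s , s′) (u , u′) (v , v′)) (x , y) =
    coordinate o a c , coordinate o′ b d
    where
    coordinate : ∀ o a c →
      ι (o ℤ.+ (s ℤ.* a ℤ.+ s′ ℤ.* c)) + x * ι (u ℤ.* a ℤ.+ u′ ℤ.* c) + y * ι (v ℤ.* a ℤ.+ v′ ℤ.* c) ≈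
      ι o + (ι s + x * ι u + y * ι v) * ι a + (ι s′ + x * ι u′ + y * ι v′) * ι c
    coordinate o a c = trans
      (+-cong (+-cong (ι-aff o s s′ a c) (*-congˡ (ι-lin u u′ a c))) (*-congˡ (ι-lin v v′ a c)))
      (solve 11 (λ o a c s s′ u u′ v v′ x y →
        (o :+ s :* a :+ s′ :* c) :+ x :* (u :* a :+ u′ :* c) :+ y :* (v :* a :+ v′ :* c) :=
        o :+ (s :+ x :* u :+ y :* v) :* a :+ (s′ :+ x :* u′ :+ y :* v′) :* c)
        refl (ι o) (ι a) (ι c) (ι s) (ι s′) (ι u) (ι u′) (ι v) (ι v′) x y)

  ⅕·5 : ∀ x → ⅕ * (ι (+ 5) * x) ≈ x
  ⅕·5 x = trans (solve 3 (λ g f x → g :* (f :* x) := (f :* g) :* x) refl ⅕ (ι (+ 5)) x)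
                (trans (*-congʳ 5*⅕) (*-identityˡ x))

  ⟪expand⟫ : ∀ ρ p → ⅕ · ⟪ expand ρ ⟫ p ≈ₚ ⟪ ρ ⟫ (⅕ · p)
  ⟪expand⟫ (pose (o , o′) (a , b) (c , d)) (x , y) = coordinate o a c , coordinate o′ b d
    where
    coordinate : ∀ o a c → ⅕ * (ι (+ 5 ℤ.* o) + x * ι a + y * ι c) ≈ ι o + (⅕ * x) * ι a + (⅕ * y) * ι c
    coordinate o a c = trans
      (*-congˡ (+-congʳ (+-congʳ (ι-* (+ 5) o))))
      (trans
        (solve 6 (λ g o a c x y →
          g :* ((con (+ 5) :* o) :+ x :* a :+ y :* c) :=
          (g :* (con (+ 5) :* o)) :+ (g :* x) :* a :+ (g :* y) :* c) refl ⅕ (ι o) (ι a) (ι c) x y)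
        (+-congʳ (+-congʳ (⅕·5 (ι o)))))

  InK : Point → Set
  InK (x , y) = 0# ≤ x × 0# ≤ y × 2# * x + y ≤ 2#

  private
    0≤x+x⇒0≤x : ∀ {x} → 0# ≤ x + x → 0# ≤ x
    0≤x+x⇒0≤x {x} h =
      [ (λ 0≤x → 0≤x) , (λ x≤0 → ≤-trans h (≤-resp refl (+-identityˡ x) (+-monoˡ-≤ x x≤0))) ]′
        (≤-total 0# x)

  opaque
    -- Twice the value at `(x , y)` is the sum of the corner values with the nonnegative weights 2 -
    -- (2x + y), 2x and y.
    K-nonneg : ∀ a b c → All (λ (x , y) → 0# ≤ a + ι x * b + ι y * c) corners° →
               ∀ {p} → InK p → 0# ≤ a + proj₁ p * b + proj₂ p * c
    K-nonneg a b c (h₀ ∷ h₁ ∷ h₂ ∷ []) {x , y} (0≤x , 0≤y , 2x+y≤2) = 0≤x+x⇒0≤x (0≤-resp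
      (solve 5 (λ a b c x y →
        let h = λ u v → a :+ con u :* b :+ con v :* c in
        (two :- (two :* x :+ y)) :* h (+ 0) (+ 0) :+ (x :+ x) :* h (+ 1) (+ 0) :+ y :* h (+ 0) (+ 2) :=
        (a :+ x :* b :+ y :* c) :+ (a :+ x :* b :+ y :* c)) refl a b c x y)
      (0≤+ (0≤+ (*-nonneg (x≤y⇒0≤y-x 2x+y≤2) h₀) (*-nonneg (0≤+ 0≤x 0≤x) h₁)) (*-nonneg 0≤y h₂)))

  opaque
    inTriangle⇒InK : ∀ {t z} → InTriangle t z → ∃[ q ] InK q × z ≈ₚ at t q
    inTriangle⇒InK {t} (α , β , γ , 0≤α , 0≤β , 0≤γ , sum , e) =
      (β , γ + γ) , (0≤β , 0≤+ 0≤γ 0≤γ , 2β+2γ≤2) ,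
      ≈ₚ.trans e (coordinate _ _ _ , coordinate _ _ _)
      where
      α≈ : α ≈ 1# - β - γ
      α≈ = trans (solve 3 (λ α β γ → α := (α :+ β :+ γ) :- β :- γ) refl α β γ)
                 (+-congʳ (+-congʳ sum))
      2β+2γ≤2 : 2# * β + (γ + γ) ≤ 2#
      2β+2γ≤2 = 0≤y-x⇒x≤y (0≤-resp (trans (+-cong α≈ α≈)
        (solve 2 (λ β γ → let a = con (+ 1) :- β :- γ in
          a :+ a := two :- (two :* β :+ (γ :+ γ))) refl β γ)) (0≤+ 0≤α 0≤α))
      γ≈ : γ ≈ (γ + γ) * ½
      γ≈ = trans (halve γ) (sym (distribʳ ½ γ γ))
      coordinate : ∀ a b c → α * a + β * b + γ * c ≈ bary a b c β ((γ + γ) * ½)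
      coordinate a b c = trans (+-congʳ (+-congʳ (*-congʳ α≈))) (trans
        (solve 5 (λ β γ a b c → (con (+ 1) :- β :- γ) :* a :+ β :* b :+ γ :* c := baryP a b c β γ)
          refl β γ a b c)
        (bary-cong refl refl refl refl γ≈))

  opaque
    at-line : ∀ t {α β} → α + β ≈ 1# → ∀ p q →
              α · at t p +ₚ β · at t q ≈ₚ at t (α · p +ₚ β · q)
    at-line (△ (a , a′) (b , b′) (c , c′)) {α} {β} sum (x , y) (x′ , y′) =
      coordinate a b c , coordinate a′ b′ c′
      where
      open ≈-Reasoning
      coordinate : ∀ a b c →
        α * bary a b c x (y * ½) + β * bary a b c x′ (y′ * ½) ≈
        bary a b c (α * x + β * x′) ((α * y + β * y′) * ½)
      coordinate a b c = begin
        α * bary a b c x (y * ½) + β * bary a b c x′ (y′ * ½)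
          ≈⟨ solve 10 (λ h α β a b c x y x′ y′ →
               α :* baryP a b c x (y :* h) :+ β :* baryP a b c x′ (y′ :* h) :=
               (α :+ β) :* a :+ ((α :* x :+ β :* x′) :* (b :- a) :+ ((α :* y :+ β :* y′) :* h) :* (c :- a)))
               refl ½ α β a b c x y x′ y′ ⟩
        (α + β) * a + ((α * x + β * x′) * (b - a) + ((α * y + β * y′) * ½) * (c - a))
          ≈⟨ +-congʳ (trans (*-congʳ sum) (*-identityˡ a)) ⟩
        a + ((α * x + β * x′) * (b - a) + ((α * y + β * y′) * ½) * (c - a))
          ≈⟨ +-assoc _ _ _ ⟨
        bary a b c (α * x + β * x′) ((α * y + β * y′) * ½) ∎

  opaque
    at-corners : ∀ t → at t (ιₚ right°) ≈ₚ right t × at t (ιₚ short°) ≈ₚ short t × at t (ιₚ long°) ≈ₚ long t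
    at-corners (△ (a , a′) (b , b′) (c , c′)) =
      (r a b c , r a′ b′ c′) , (s a b c , s a′ b′ c′) , (l a b c , l a′ b′ c′)
      where
      k0 : 0# * ½ ≈ 0#
      k0 = zeroˡ ½
      k1 : 2# * ½ ≈ 1#
      k1 = trans (distribʳ ½ 1# 1#) (trans (+-cong (*-identityˡ ½) (*-identityˡ ½)) ½+½)
      r : ∀ a b c → bary a b c 0# (0# * ½) ≈ a
      r a b c = trans (bary-cong refl refl refl refl k0)
        (solve 3 (λ a b c → baryP a b c (con (+ 0)) (con (+ 0)) := a) refl a b c)
      s : ∀ a b c → bary a b c 1# (0# * ½) ≈ b
      s a b c = trans (bary-cong refl refl refl refl k0)
        (solve 3 (λ a b c → baryP a b c (con (+ 1)) (con (+ 0)) := b) refl a b c)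
      l : ∀ a b c → bary a b c 0# (2# * ½) ≈ c
      l a b c = trans (bary-cong refl refl refl refl k1)
        (solve 3 (λ a b c → baryP a b c (con (+ 0)) (con (+ 1)) := c) refl a b c)

  -- A similarity of ratio √5 that takes the corners (0,0), (2,-1), (2,4) of the expanded tile to
  -- (0,0), (5,0), (0,10). It links `place` with the integral coordinates of `piece`.
  σ : Point → Point
  σ (x , y) = 2# * x - y , x + 2# * y

  opaque
    place-scaled : ∀ s t p → place (mapTriangle (s ·_) t) p ≈ₚ s · at t (⅕ · σ p)
    place-scaled s (△ (a , a′) (b , b′) (c , c′)) (x , y) = coordinate a b c , coordinate a′ b′ c′
      where
      coordinate : ∀ a b c →
        s * a + ((2# * x - y) * ⅕) * (s * b - s * a) + ((x + 2# * y) * 10# ⁻¹) * (s * c - s * a) ≈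
        s * bary a b c (⅕ * (2# * x - y)) ((⅕ * (x + 2# * y)) * ½)
      coordinate a b c = trans (+-congˡ (*-congʳ (*-congˡ 10⁻¹≈½*⅕)))
        (solve 8 (λ s a b c g h x y →
          s :* a :+ ((two :* x :- y) :* g) :* (s :* b :- s :* a) :+
            ((x :+ two :* y) :* (h :* g)) :* (s :* c :- s :* a) :=
          s :* baryP a b c (g :* (two :* x :- y)) ((g :* (x :+ two :* y)) :* h))
          refl s a b c ⅕ ½ x y)

  opaque
    piece-frame : ∀ j p → σ (at (List.lookup pieces j) p) ≈ₚ ⟪ piece j ⟫ p
    piece-frame j (x , y) = ≈ₚ.trans (halved j) (⟪⟫-cong (piece j) (refl , sym (halve y)))
      where
      k : Carrier
      k = y * ½
      PointP : Set
      PointP = Polynomial 2 × Polynomial 2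
      corners′ : Fin 5 → PointP × PointP × PointP
      corners′ 0F = (two , con (+ 0)) , (two , (:- con (+ 1))) , (con (+ 0) , con (+ 0))
      corners′ 1F = (con (+ 1) , con (+ 0)) , (con (+ 0) , con (+ 0)) , (con (+ 1) , two)
      corners′ 2F = (two , con (+ 0)) , (con (+ 1) , con (+ 0)) , (two , two)
      corners′ 3F = (con (+ 1) , two) , (two , two) , (con (+ 1) , con (+ 0))
      corners′ 4F = (two , two) , (con (+ 1) , two) , (two , (two :+ two))
      equation₁ equation₂ : Fin 5 → Polynomial 2 → Polynomial 2 → Polynomial 2 × Polynomial 2
      equation₁ j x k =
        let ((p , p′) , (q , q′) , (r , r′)) = corners′ j
            (pose (o , _) (a , _) (c , _)) = piece j
        in two :* baryP p q r x k :- baryP p′ q′ r′ x k := con o :+ x :* con a :+ (k :+ k) :* con c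
      equation₂ j x k =
        let ((p , p′) , (q , q′) , (r , r′)) = corners′ j
            (pose (_ , o) (_ , a) (_ , c)) = piece j
        in baryP p q r x k :+ two :* baryP p′ q′ r′ x k := con o :+ x :* con a :+ (k :+ k) :* con c
      halved : ∀ j → σ (at (List.lookup pieces j) (x , y)) ≈ₚ ⟪ piece j ⟫ (x , k + k)
      halved 0F = solve 2 (equation₁ 0F) refl x k , solve 2 (equation₂ 0F) refl x k
      halved 1F = solve 2 (equation₁ 1F) refl x k , solve 2 (equation₂ 1F) refl x k
      halved 2F = solve 2 (equation₁ 2F) refl x k , solve 2 (equation₂ 2F) refl x k
      halved 3F = solve 2 (equation₁ 3F) refl x k , solve 2 (equation₂ 3F) refl x k
      halved 4F = solve 2 (equation₁ 4F) refl x k , solve 2 (equation₂ 4F) refl x k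

  opaque
    at-map : ∀ t (p q r : Point) x → at (mapTriangle (at t) (△ p q r)) x ≈ₚ at t (at (△ p q r) x)
    at-map (△ (a , a′) (b , b′) (c , c′)) (p , p′) (q , q′) (r , r′) (x , y) =
      coordinate a b c , coordinate a′ b′ c′
      where
      k : Carrier
      k = y * ½
      coordinate : ∀ a b c →
        bary (bary a b c p (p′ * ½)) (bary a b c q (q′ * ½)) (bary a b c r (r′ * ½)) x k ≈
        bary a b c (bary p q r x k) (bary p′ q′ r′ x k * ½)
      coordinate a b c = solve 12 (λ a b c h x k p p′ q q′ r r′ →
        baryP (baryP a b c p (p′ :* h)) (baryP a b c q (q′ :* h)) (baryP a b c r (r′ :* h)) x k :=
        baryP a b c (baryP p q r x k) (baryP p′ q′ r′ x k :* h)) refl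
        a b c ½ x k p p′ q q′ r r′

  part : Carrier → Triangle → Fin 5 → Triangle
  part s t j = mapTriangle (place (mapTriangle (s ·_) t)) (List.lookup pieces j)

  opaque
    -- The factor `s` is the expansion, and `⅕` undoes the enlargement built into `piece`. Through
    -- this formula the substitution is governed by integral placements.
    at-part : ∀ s t j p → at (part s t j) p ≈ₚ s · at t (⅕ · ⟪ piece j ⟫ p)
    at-part s t j p = begin
      at (part s t j) p
        ≈⟨ at-cong (place-scaled s t _ , place-scaled s t _ , place-scaled s t _) ≈ₚ.refl ⟩
      at (mapTriangle (s ·_) (mapTriangle (at t) (mapTriangle (λ x → ⅕ · σ x) u))) p
        ≈⟨ at-· s (mapTriangle (at t) (mapTriangle (λ x → ⅕ · σ x) u)) p ⟩
      s · at (mapTriangle (at t) (mapTriangle (λ x → ⅕ · σ x) u)) p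
        ≈⟨ ·-congˡ (at-map t (⅕ · σ (right u)) (⅕ · σ (short u)) (⅕ · σ (long u)) p) ⟩
      s · at t (at (mapTriangle (λ x → ⅕ · σ x) u) p)
        ≈⟨ ·-congˡ (at-congʳ t (≈ₚ.trans (at-· ⅕ (mapTriangle σ u) p) (·-congˡ (at-σ u p)))) ⟩
      s · at t (⅕ · σ (at u p))
        ≈⟨ ·-congˡ (at-congʳ t (·-congˡ (piece-frame j p))) ⟩
      s · at t (⅕ · ⟪ piece j ⟫ p) ∎
      where
      open ≈ₚ-Reasoning
      u : Triangle
      u = List.lookup pieces j
      at-· : ∀ s t p → at (mapTriangle (s ·_) t) p ≈ₚ s · at t p
      at-· s (△ (a , a′) (b , b′) (c , c′)) (x , y) = coordinate a b c , coordinate a′ b′ c′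
        where
        coordinate : ∀ a b c → bary (s * a) (s * b) (s * c) x (y * ½) ≈ s * bary a b c x (y * ½)
        coordinate a b c = solve 6 (λ s a b c x k →
          baryP (s :* a) (s :* b) (s :* c) x k := s :* baryP a b c x k) refl s a b c x (y * ½)
      at-σ : ∀ t p → at (mapTriangle σ t) p ≈ₚ σ (at t p)
      at-σ (△ (a , a′) (b , b′) (c , c′)) (x , y) =
        solve 8 (λ a b c a′ b′ c′ x k →
          baryP (two :* a :- a′) (two :* b :- b′) (two :* c :- c′) x k :=
          two :* baryP a b c x k :- baryP a′ b′ c′ x k) refl a b c a′ b′ c′ x (y * ½) ,
        solve 8 (λ a b c a′ b′ c′ x k →
          baryP (a :+ two :* a′) (b :+ two :* b′) (c :+ two :* c′) x k :=
          baryP a b c x k :+ two :* baryP a′ b′ c′ x k) refl a b c a′ b′ c′ x (y * ½)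

  opaque
    dist²-piece : ∀ j p q → dist² (⟪ piece j ⟫ p) (⟪ piece j ⟫ q) ≈ 5# * dist² p q
    dist²-piece j (x , y) (x′ , y′) = by-cases j
      where
      d : ∀ {n} → (x y x′ y′ : Polynomial n) → Polynomial n
      d x y x′ y′ = (x :- x′) :* (x :- x′) :+ (y :- y′) :* (y :- y′)
      equation : Fin 5 → (x y x′ y′ : Polynomial 4) → Polynomial 4 × Polynomial 4
      equation j x y x′ y′ =
        let (pose (o , o′) (a , b) (c , e)) = piece j
            f = λ x y → con o :+ x :* con a :+ y :* con c
            g = λ x y → con o′ :+ x :* con b :+ y :* con e
        in d (f x y) (g x y) (f x′ y′) (g x′ y′) := five :* d x y x′ y′
      by-cases : ∀ j → dist² (⟪ piece j ⟫ (x , y)) (⟪ piece j ⟫ (x′ , y′)) ≈ 5# * dist² (x , y) (x′ , y′)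
      by-cases 0F = solve 4 (equation 0F) refl x y x′ y′
      by-cases 1F = solve 4 (equation 1F) refl x y x′ y′
      by-cases 2F = solve 4 (equation 2F) refl x y x′ y′
      by-cases 3F = solve 4 (equation 3F) refl x y x′ y′
      by-cases 4F = solve 4 (equation 4F) refl x y x′ y′

  0≤⅕ : 0# ≤ ⅕
  0≤⅕ = 0≤-resp (⅕·5 ⅕) (≤-resp refl (solve 1 (λ g → con (+ 5) :* (g :* g) := g :* (con (+ 5) :* g)) refl ⅕)
    (*-nonneg (0≤ι+ 5) (0≤x² ⅕)))

  -- Separation by linear functionals

  dot : ℤ² → Point → Carrier
  dot (a , b) (x , y) = ι a * x + ι b * y

  dot-ι : ∀ g z → dot g (ιₚ z) ≈ ι (g • z)
  dot-ι (a , b) (x , y) = sym (trans (ι-+ (a ℤ.* x) (b ℤ.* y)) (+-cong (ι-* a x) (ι-* b y)))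

  dot-cong : ∀ g {p q} → p ≈ₚ q → dot g p ≈ dot g q
  dot-cong g (x , y) = +-cong (*-congˡ x) (*-congˡ y)

  dot-⟪⟫ : ∀ g ρ z → dot g (⟪ ρ ⟫ (ιₚ z)) ≈ ι (g • ρ ⟨ z ⟩)
  dot-⟪⟫ g ρ z = trans (dot-cong g (⟪⟫-ιₚ ρ z)) (dot-ι g (ρ ⟨ z ⟩))

  opaque
    dot-min : ∀ g ρ m → All (λ q → m ≤ dot g (⟪ ρ ⟫ (ιₚ q))) corners° →
              ∀ {p} → InK p → m ≤ dot g (⟪ ρ ⟫ p)
    dot-min (a , b) (pose (o , o′) (u , u′) (v , v′)) m h {x , y} p∈K =
      0≤y-x⇒x≤y (0≤-resp (sym (expanded x y)) (K-nonneg _ _ _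
        (All.map (λ {(x , y)} h → 0≤-resp (expanded (ι x) (ι y)) (x≤y⇒0≤y-x h)) h) p∈K))
      where
      expanded : ∀ x y →
        (ι a * (ι o + x * ι u + y * ι v) + ι b * (ι o′ + x * ι u′ + y * ι v′)) - m ≈
        (ι a * ι o + ι b * ι o′ - m) + x * (ι a * ι u + ι b * ι u′) + y * (ι a * ι v + ι b * ι v′)
      expanded x y = solve 11 (λ a b o o′ u u′ v v′ x y m →
        (a :* (o :+ x :* u :+ y :* v) :+ b :* (o′ :+ x :* u′ :+ y :* v′)) :- m :=
        (a :* o :+ b :* o′ :- m) :+ x :* (a :* u :+ b :* u′) :+ y :* (a :* v :+ b :* v′))
        refl (ι a) (ι b) (ι o) (ι o′) (ι u) (ι u′) (ι v) (ι v′) x y m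

  opaque
    dot-minℤ : ∀ g ρ m → All (λ q → m ℤ.≤ g • ρ ⟨ q ⟩) corners° →
               ∀ {p} → InK p → ι m ≤ dot g (⟪ ρ ⟫ p)
    dot-minℤ g ρ m h = dot-min g ρ (ι m)
      (All.map (λ {q} h → ≤-resp refl (sym (dot-⟪⟫ g ρ q)) (ι-mono-≤ h)) h)

  opaque
    piece-InK : ∀ j {p} → InK p → InK (⅕ · ⟪ piece j ⟫ p)
    piece-InK j {p} p∈K =
      0≤⅕* (≤-resp refl (solve 2 (λ x y → (con (+ 1) :* x :+ con (+ 0) :* y) := x) refl _ _)
                        (bound (here ≡.refl))) ,
      0≤⅕* (≤-resp refl (solve 2 (λ x y → (con (+ 0) :* x :+ con (+ 1) :* y) := y) refl _ _)
                        (bound (there (here ≡.refl)))) ,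
      0≤y-x⇒x≤y (0≤-resp
        (trans (solve 3 (λ g x y →
           g :* ((con (ℤ.- + 2) :* x :+ con (ℤ.- + 1) :* y) :- con (ℤ.- + 10)) :=
           g :* (con (+ 5) :* two) :- (two :* (g :* x) :+ g :* y)) refl ⅕ _ _) (+-congʳ (⅕·5 2#)))
        (0≤⅕* (x≤y⇒0≤y-x (bound (there (there (here ≡.refl)))))))
      where
      0≤⅕* : ∀ {x} → 0# ≤ x → 0# ≤ ⅕ * x
      0≤⅕* = *-nonneg 0≤⅕
      bound : ∀ {g m} → (g , m) ∈ halfPlanes → ι m ≤ dot g (⟪ piece j ⟫ p)
      bound {g} {m} i = dot-minℤ g (piece j) m (All.lookup (pieces-inside j) i) p∈K

  ≤-<-trans : ∀ {x y z} → x ≤ y → y < z → x < z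
  ≤-<-trans x≤y (y≤z , y≉z) =
    ≤-trans x≤y y≤z , λ x≈z → y≉z (≤-antisym y≤z (≤-resp x≈z refl x≤y))

  <-respˡ : ∀ {x y z} → x ≈ y → x < z → y < z
  <-respˡ e = ≤-<-trans (≤-reflexive (sym e))

  opaque
    -- A linear form on a triangle is extremal at corners. This is used twice: for each corner of
    -- the first tile to minimise over the second, then with `- g` to maximise over the first.
    far-gap : ∀ {σ τ} → Far σ τ → ∀ {p q} → InK p → InK q →
              ∃[ g ] ∃[ n ] n ℤ.* n ≡ g • g × ¬ (n ≡ + 0) × (+ 0 ℤ.≤ n) ×
                dot g (⟪ σ ⟫ p) + ι n ≤ dot g (⟪ τ ⟫ q)
    far-gap {σ} {τ} far {p} {q} p∈K q∈K with find far
    ... | (g@(a , b) , n) , i , separated with All.lookup directions-normed i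
    ...   | n²≡g² , n≢0 , 0≤n = g , n , n²≡g² , n≢0 , 0≤n , 0≤y-x⇒x≤y (0≤-resp
      (solve 6 (λ a b x y n m →
        ((:- a) :* x :+ (:- b) :* y) :- (n :- m) := m :- ((a :* x :+ b :* y) :+ n)) refl
        (ι a) (ι b) _ _ (ι n) _)
      (x≤y⇒0≤y-x (≤-resp refl (+-cong (*-congʳ (ι-neg a)) (*-congʳ (ι-neg b)))
        (dot-min (ℤ.- a , ℤ.- b) σ (ι n - dot g (⟪ τ ⟫ q)) (All.map (λ {c} → gap c) separated) p∈K))))
      where
      gap : ∀ c → All (λ q → g • σ ⟨ c ⟩ ℤ.+ n ℤ.≤ g • τ ⟨ q ⟩) corners° →
            ι n - dot g (⟪ τ ⟫ q) ≤ dot (ℤ.- a , ℤ.- b) (⟪ σ ⟫ (ιₚ c))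
      gap c h = 0≤y-x⇒x≤y (0≤-resp
        (trans (+-congˡ (-‿cong (trans (ι-+ (g • σ ⟨ c ⟩) n) (+-congʳ (sym (dot-⟪⟫ g σ c))))))
          (trans (solve 6 (λ a b x y n m →
             m :- ((a :* x :+ b :* y) :+ n) := ((:- a) :* x :+ (:- b) :* y) :- (n :- m)) refl
             (ι a) (ι b) _ _ (ι n) _)
           (+-congʳ (+-cong (*-congʳ (sym (ι-neg a))) (*-congʳ (sym (ι-neg b)))))))
        (x≤y⇒0≤y-x (dot-minℤ g τ (g • σ ⟨ c ⟩ ℤ.+ n) h q∈K)))

  -- `D` and `E` are the inner and the cross product of `g` with the difference vector, so D² + E² =
  -- n²d. As -D ≥ n, `lagrange` writes 0 as a sum of terms that are nonnegative when d ≤ 1; so n²(1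
  -- - d) vanishes and d is 1.
  far-apart : ∀ {σ τ} → Far σ τ → ∀ {p q} → InK p → InK q → ¬ (dist² (⟪ σ ⟫ p) (⟪ τ ⟫ q) < 1#)
  far-apart {σ} {τ} far {p} {q} p∈K q∈K (d≤1 , d≉1) with far-gap {σ} {τ} far p∈K q∈K
  ... | g@(a , b) , n , n²≡g² , n≢0 , 0≤n , gap = d≉1 (sym (x-y≈0⇒x≈y (*-zero⇒ n≉0 (*-zero⇒ n≉0
        (trans (sym (*-assoc _ _ _)) n²[1-d]≈0)))))
    where
    x = proj₁ (⟪ σ ⟫ p)
    y = proj₂ (⟪ σ ⟫ p)
    x′ = proj₁ (⟪ τ ⟫ q)
    y′ = proj₂ (⟪ τ ⟫ q)
    D E d : Carrier
    D = ι a * (x - x′) + ι b * (y - y′)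
    E = ι a * (y - y′) - ι b * (x - x′)
    d = dist² (⟪ σ ⟫ p) (⟪ τ ⟫ q)
    n≉0 : ¬ (ι n ≈ 0#)
    n≉0 e = n≢0 (ι-injective {n} {+ 0} e)
    0≤ιn : 0# ≤ ι n
    0≤ιn = ι-mono-≤ 0≤n
    0≤-D-n : 0# ≤ - D - ι n
    0≤-D-n = 0≤-resp (solve 7 (λ a b n x y x′ y′ →
      (a :* x′ :+ b :* y′) :- (a :* x :+ b :* y :+ n) := :- (a :* (x :- x′) :+ b :* (y :- y′)) :- n)
      refl (ι a) (ι b) (ι n) x y x′ y′) (x≤y⇒0≤y-x gap)
    0≤-D+n : 0# ≤ - D + ι n
    0≤-D+n = 0≤-resp (solve 2 (λ D n → (:- D :- n) :+ (n :+ n) := :- D :+ n) refl D (ι n))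
      (0≤+ 0≤-D-n (0≤+ 0≤ιn 0≤ιn))
    ιn² : ι n * ι n ≈ ι a * ι a + ι b * ι b
    ιn² = trans (sym (ι-* n n)) (trans (reflexive (≡.cong ι n²≡g²))
      (trans (ι-+ (a ℤ.* a) (b ℤ.* b)) (+-cong (ι-* a a) (ι-* b b))))
    lagrange : (- D - ι n) * (- D + ι n) + E * E + (ι n * ι n) * (1# - d) ≈ 0#
    lagrange = trans
      (solve 5 (λ a b n u v →
        let D = a :* u :+ b :* v
            E = a :* v :- b :* u
            d = u :* u :+ v :* v
        in (:- D :- n) :* (:- D :+ n) :+ E :* E :+ (n :* n) :* (con (+ 1) :- d) :=
           ((a :* a :+ b :* b) :- n :* n) :* d) refl (ι a) (ι b) (ι n) (x - x′) (y - y′))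
      (trans (*-congʳ (trans (+-congˡ (-‿cong ιn²)) (-‿inverseʳ _))) (zeroˡ d))
    n²[1-d]≈0 : (ι n * ι n) * (1# - d) ≈ 0#
    n²[1-d]≈0 = 0≤-+-zeroˡ (*-nonneg (0≤x² (ι n)) (x≤y⇒0≤y-x d≤1))
      (0≤+ (*-nonneg 0≤-D-n 0≤-D+n) (0≤x² E)) (trans (+-comm _ _) lagrange)

  -- The unit of length in the coordinates of piece is 1/√5 of the actual one, and
  -- Far pieces are at distance at least 1 in these coordinates.
  Near : Triangle → Triangle → Set
  Near t t′ = ∃[ p ] ∃[ q ] InK p × InK q × 5# * dist² (at t p) (at t′ q) < 1#

  Placed : Placement → Triangle → Triangle → Set
  Placed ρ t t′ = ∀ p → at t′ p ≈ₚ at t (⟪ ρ ⟫ p)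

  0≤5 : 0# ≤ 5#
  0≤5 = 0≤-resp (sym 5≈ι5) (0≤ι+ 5)

  ¼ : Carrier
  ¼ = ½ * ½

  4*¼ : ∀ x → ι (+ 4) * (¼ * x) ≈ x
  4*¼ x = begin
    ι (+ 4) * (¼ * x)          ≈⟨ solve 2 (λ h x → con (+ 4) :* (h :* h :* x) := (h :+ h) :* (h :+ h) :* x) refl ½ x ⟩
    (½ + ½) * (½ + ½) * x      ≈⟨ *-congʳ (trans (*-cong ½+½ ½+½) (*-identityˡ 1#)) ⟩
    1# * x                     ≈⟨ *-identityˡ x ⟩
    x                          ∎
    where open ≈-Reasoning

  0≤½ : 0# ≤ ½
  0≤½ = 0≤-resp (sym (halve ½)) (0≤+ (0≤x² ½) (0≤x² ½))

  0≤¼ : 0# ≤ ¼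
  0≤¼ = 0≤x² ½

  quarter : ℤ² → Point
  quarter z = ¼ · ιₚ z

  dot-quarter : ∀ g z → dot g (quarter z) ≈ ¼ * ι (g • z)
  dot-quarter g@(a , b) z@(x , y) = trans
    (solve 5 (λ q a b x y → a :* (q :* x) :+ b :* (q :* y) := q :* (a :* x :+ b :* y)) refl
      ¼ (ι a) (ι b) (ι x) (ι y))
    (*-congˡ (dot-ι g z))

  0≤-¼ : ∀ {x} → 0# ≤ x → 0# ≤ ¼ * x
  0≤-¼ = *-nonneg 0≤¼

  opaque
    outside⇒∉ : ∀ {z ρ} → Outside z ρ → ∀ {q} → InK q → ¬ (quarter z ≈ₚ ⟪ ρ ⟫ q)
    outside⇒∉ {z} {ρ} out {q} q∈K z≈ρq = contra (find out)
      where
      contra : ¬ (∃[ g ] g ∈ normals × All (λ c → g • z ℤ.< + 4 ℤ.* (g • ρ ⟨ c ⟩)) corners°)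
      -- Strictly ordered integers differ by at least 1: `ℤ.suc` turns the strict corner
      -- inequalities into weak ones, to which `dot-min` applies.
      contra (g , _ , h) = ℤ.<-irrefl ≡.refl (ℤ.suc[i]≤j⇒i<j (ι-cancel-≤ {ℤ.suc (g • z)} {g • z}
        (≤-resp (4*¼ _) (4*¼ _) (4*-mono
          (≤-resp refl (trans (dot-cong g (≈ₚ.sym z≈ρq)) (dot-quarter g z))
            (dot-min g ρ (¼ * ι (ℤ.suc (g • z))) (All.map (λ {c} → corner c) h) q∈K))))))
        where
        4*-mono : ∀ {x y} → x ≤ y → ι (+ 4) * x ≤ ι (+ 4) * y
        4*-mono {x} {y} h = 0≤y-x⇒x≤y (0≤-resp
          (solve 2 (λ x y → con (+ 4) :* (y :- x) := con (+ 4) :* y :- con (+ 4) :* x) refl x y)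
          (*-nonneg (0≤ι+ 4) (x≤y⇒0≤y-x h)))
        corner : ∀ c → g • z ℤ.< + 4 ℤ.* (g • ρ ⟨ c ⟩) → ¼ * ι (ℤ.suc (g • z)) ≤ dot g (⟪ ρ ⟫ (ιₚ c))
        corner c h = 0≤y-x⇒x≤y (0≤-resp
          (trans (solve 3 (λ q x y → q :* (con (+ 4) :* y :- x) := con (+ 4) :* (q :* y) :- q :* x) refl
                    ¼ (ι (ℤ.suc (g • z))) (ι (g • ρ ⟨ c ⟩)))
            (+-congʳ (trans (4*¼ _) (sym (dot-⟪⟫ g ρ c)))))
          (0≤-¼ (x≤y⇒0≤y-x (≤-resp refl (ι-* (+ 4) (g • ρ ⟨ c ⟩)) (ι-mono-≤ (ℤ.i<j⇒suc[i]≤j h))))))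

  ι-2x+y : ∀ x y → ι (+ 2 ℤ.* x ℤ.+ y) ≈ 2# * ι x + ι y
  ι-2x+y x y = trans (ι-+ (+ 2 ℤ.* x) y) (+-congʳ (ι-* (+ 2) x))

  opaque
    ι-InK : ∀ {z} → InKℤ (+ 2) z → InK (ιₚ z)
    ι-InK {x , y} (0≤x , 0≤y , h) = ι-mono-≤ 0≤x , ι-mono-≤ 0≤y , ≤-resp (ι-2x+y x y) refl (ι-mono-≤ h)

  opaque
    InK-ι : ∀ {z} → InK (ιₚ z) → InKℤ (+ 2) z
    InK-ι {x , y} (0≤x , 0≤y , h) =
      ι-cancel-≤ {+ 0} 0≤x , ι-cancel-≤ {+ 0} 0≤y ,
      ι-cancel-≤ {_} {+ 2} (≤-resp (sym (ι-2x+y x y)) refl h)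

  opaque
    quarter-InK : ∀ {z} → InKℤ (+ 8) z → InK (quarter z)
    quarter-InK {x , y} (0≤x , 0≤y , h) =
      0≤-¼ (ι-mono-≤ 0≤x) , 0≤-¼ (ι-mono-≤ 0≤y) ,
      0≤y-x⇒x≤y (0≤-resp
        (trans (solve 3 (λ q x y → q :* (con (+ 8) :- (two :* x :+ y)) :=
                   con (+ 4) :* (q :* two) :- (two :* (q :* x) :+ q :* y)) refl ¼ (ι x) (ι y))
          (+-congʳ (4*¼ 2#)))
        (0≤-¼ (x≤y⇒0≤y-x (≤-resp (ι-2x+y x y) refl (ι-mono-≤ h)))))

  InK-resp : ∀ {p q} → p ≈ₚ q → InK p → InK q
  InK-resp (x , y) (0≤x , 0≤y , h) = 0≤-resp x 0≤x , 0≤-resp y 0≤y , ≤-resp (+-cong (*-congˡ x) y) refl h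

  opaque
    InK-line : ∀ {p q α β} → InK p → InK q → 0# ≤ α → 0# ≤ β → α + β ≈ 1# → InK (α · p +ₚ β · q)
    InK-line {x , y} {x′ , y′} {α} {β} (0≤x , 0≤y , h) (0≤x′ , 0≤y′ , h′) 0≤α 0≤β sum =
      0≤+ (*-nonneg 0≤α 0≤x) (*-nonneg 0≤β 0≤x′) , 0≤+ (*-nonneg 0≤α 0≤y) (*-nonneg 0≤β 0≤y′) ,
      0≤y-x⇒x≤y (0≤-resp
        (trans (solve 6 (λ α β x y x′ y′ →
            α :* (two :- (two :* x :+ y)) :+ β :* (two :- (two :* x′ :+ y′)) :=
            (α :+ β) :* two :- (two :* (α :* x :+ β :* x′) :+ (α :* y :+ β :* y′))) refl α β x y x′ y′)
          (+-congʳ (trans (*-congʳ sum) (*-identityˡ 2#))))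
        (0≤+ (*-nonneg 0≤α (x≤y⇒0≤y-x h)) (*-nonneg 0≤β (x≤y⇒0≤y-x h′))))

  ιₚ-injective : ∀ {z w} → ιₚ z ≈ₚ ιₚ w → z ≡ w
  ιₚ-injective (x , y) = ≡.cong₂ _,_ (ι-injective x) (ι-injective y)

  dist²-ιₚ : ∀ z w → dist² (ιₚ z) (ιₚ w) ≈ ι (dist²ℤ z w)
  dist²-ιₚ (x , y) (x′ , y′) = sym (trans (ι-+ ((x ℤ.- x′) ℤ.* (x ℤ.- x′)) _) (+-cong (sq x x′) (sq y y′)))
    where
    sq : ∀ x y → ι ((x ℤ.- y) ℤ.* (x ℤ.- y)) ≈ (ι x - ι y) * (ι x - ι y)
    sq x y = trans (ι-* (x ℤ.- y) (x ℤ.- y)) (*-cong (ι-- x y) (ι-- x y))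

  opaque
    -- The points are a quarter apart and 5/16 < 1, with 11/16 to spare; half a unit would already
    -- be too far.
    near-probe : ∀ {z a} → Anchor z a → 5# * dist² (quarter a) (quarter z) < 1#
    near-probe {z} {a} (d≡1 , _) = <-respˡ (sym eq) (5*¼²<1)
      where
      eq : 5# * dist² (quarter a) (quarter z) ≈ 5# * (¼ * ¼)
      eq = *-congˡ (trans (dist²-· ¼ (ιₚ a) (ιₚ z)) (trans (*-congˡ (trans
        (solve 4 (λ x y x′ y′ → (x :- x′) :* (x :- x′) :+ (y :- y′) :* (y :- y′) :=
                                (x′ :- x) :* (x′ :- x) :+ (y′ :- y) :* (y′ :- y)) refl _ _ _ _)
        (trans (dist²-ιₚ z a) (reflexive (≡.cong ι d≡1))))) (*-identityʳ _)))
      one : ι (+ 16) * (¼ * ¼) ≈ 1#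
      one = trans (solve 1 (λ q → con (+ 16) :* (q :* q) := con (+ 4) :* (q :* (con (+ 4) :* (q :* con (+ 1))))) refl ¼)
                  (trans (4*¼ _) (4*¼ 1#))
      gap : ι (+ 11) * (¼ * ¼) ≈ 1# - 5# * (¼ * ¼)
      gap = trans (solve 1 (λ q → con (+ 11) :* (q :* q) := con (+ 16) :* (q :* q) :- five :* (q :* q)) refl ¼)
        (+-congʳ one)
      11≢0 : ¬ (+ 11 ≡ + 0)
      11≢0 ()
      5*¼²<1 : 5# * (¼ * ¼) < 1#
      5*¼²<1 = 0≤y-x⇒x≤y (0≤-resp gap (*-nonneg (0≤ι+ 11) (0≤x² ¼))) , λ e → 1≉0 (trans (sym one) (trans
        (*-congˡ (*-zero⇒ (λ e → 11≢0 (ι-injective {+ 11} {+ 0} e))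
          (trans gap (trans (+-congˡ (-‿cong e)) (-‿inverseʳ 1#)))))
        (zeroʳ _)))

  opaque
    near-point : ∀ {t t′ p q} → InK p → InK q → at t p ≈ₚ at t′ q → Near t t′
    near-point {p = p} {q} p∈K q∈K e = p , q , p∈K , q∈K ,
      <-respˡ (sym (trans (*-congˡ (≈ₚ⇒dist²≈0 e)) (zeroʳ 5#))) (0≤1 , λ e → 1≉0 (sym e))

  -- What the rest of the proof may know about a patch; its isometry is hidden. `scale` stays
  -- visible because squared distances become integral only after multiplication by that power of 5.
  record Labelling : Set₁ where
    field
      Label        : Triangle → Fin 5 → Set
      placement    : ∀ {t t′ i j} → Label t i → Label t′ j → Near t t′ →
                     ∃[ ρ ] Local i j ρ × Placed ρ t t′
      scale        : ℕ
      Grid         : Point → ℤ² → Set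
      grid-dist²   : ∀ {p q a b} → Grid p a → Grid q b →
                     ι ((+ 5) ℤ.^ scale) * dist² p q ≈ ι (dist²ℤ a b)
      grid-lattice : ∀ {t i} → Label t i → ∀ z → ∃[ a ] Grid (at t (ιₚ z)) a

  -- Corners, sides and segments

  corner-InKℤ : ∀ {c} → c ∈ corners° → InKℤ (+ 2) c
  corner-InKℤ = All.lookup (toWitness {a? = All.all? (inKℤ? (+ 2)) corners°} _)

  opaque
    corner-InK : ∀ {c} → c ∈ corners° → InK (ιₚ c)
    corner-InK c∈ = ι-InK (corner-InKℤ c∈)

  opaque
    mid-InK : InK (ιₚ mid°)
    mid-InK = ι-InK (toWitness {a? = inKℤ? (+ 2) mid°} _)

  right∈ : right° ∈ corners°
  right∈ = here ≡.refl
  short∈ : short° ∈ corners°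
  short∈ = there (here ≡.refl)
  long∈ : long° ∈ corners°
  long∈ = there (there (here ≡.refl))

  at-right : ∀ t → at t (ιₚ right°) ≈ₚ right t
  at-right t = proj₁ (at-corners t)
  at-short : ∀ t → at t (ιₚ short°) ≈ₚ short t
  at-short t = proj₁ (proj₂ (at-corners t))
  at-long : ∀ t → at t (ιₚ long°) ≈ₚ long t
  at-long t = proj₂ (proj₂ (at-corners t))

  -- The trace, free of labels, of the second and fourth pieces: the long legs are the same segment,
  -- with the right angles at opposite ends.
  Reversed : Triangle → Triangle → Set
  Reversed t t′ = right t′ ≈ₚ long t × long t′ ≈ₚ right t

  Reversed-sym : ∀ {t t′} → Reversed t t′ → Reversed t′ t
  Reversed-sym (e , e′) = ≈ₚ.sym e′ , ≈ₚ.sym e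

  dot-line : ∀ g α β p q → dot g (α · p +ₚ β · q) ≈ α * dot g p + β * dot g q
  dot-line (a , b) α β (x , y) (x′ , y′) = solve 8 (λ a b α β x y x′ y′ →
    a :* (α :* x :+ β :* x′) :+ b :* (α :* y :+ β :* y′) :=
    α :* (a :* x :+ b :* y) :+ β :* (a :* x′ :+ b :* y′)) refl (ι a) (ι b) α β x y x′ y′

  line-end : ∀ {α β} → α + β ≈ 1# → ¬ (β ≈ 0#) → ∀ p q → α · p +ₚ β · q ≈ₚ p → q ≈ₚ p
  line-end {α} {β} sum β≉0 (x , y) (x′ , y′) (e , e′) = coordinate x x′ e , coordinate y y′ e′
    where
    coordinate : ∀ x x′ → α * x + β * x′ ≈ x → x′ ≈ x
    coordinate x x′ e = x-y≈0⇒x≈y (*-zero⇒ β≉0 (trans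
      (solve 4 (λ α β x x′ → β :* (x′ :- x) := (α :* x :+ β :* x′) :- (α :+ β) :* x) refl α β x x′)
      (trans (+-cong e (-‿cong (trans (*-congʳ sum) (*-identityˡ x)))) (-‿inverseʳ x))))

  line-cong : ∀ {α β p p′ q q′} → p ≈ₚ p′ → q ≈ₚ q′ → α · p +ₚ β · q ≈ₚ α · p′ +ₚ β · q′
  line-cong (x , y) (x′ , y′) = +-cong (*-congˡ x) (*-congˡ x′) , +-cong (*-congˡ y) (*-congˡ y′)

  onSegment-resp : ∀ {u u′ v v′ p} → u ≈ₚ u′ → v ≈ₚ v′ → OnSegment u v p → OnSegment u′ v′ p
  onSegment-resp e e′ (α , β , 0≤α , 0≤β , sum , h) = α , β , 0≤α , 0≤β , sum , ≈ₚ.trans h (line-cong e e′)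

  betweenSegment-resp : ∀ {u u′ v v′ p} → u ≈ₚ u′ → v ≈ₚ v′ → StrictlyBetween u v p → StrictlyBetween u′ v′ p
  betweenSegment-resp e e′ (α , β , 0<α , 0<β , sum , h) = α , β , 0<α , 0<β , sum , ≈ₚ.trans h (line-cong e e′)

  startOnSegment : ∀ u v → OnSegment u v u
  startOnSegment (x , y) (x′ , y′) = 1# , 0# , 0≤1 , ≤-refl , +-identityʳ 1# , coordinate x x′ , coordinate y y′
    where
    coordinate : ∀ x y → x ≈ 1# * x + 0# * y
    coordinate = solve 2 (λ x y → x := con (+ 1) :* x :+ con (+ 0) :* y) refl

  endOnSegment : ∀ u v → OnSegment u v v
  endOnSegment (x , y) (x′ , y′) = 0# , 1# , ≤-refl , 0≤1 , +-identityˡ 1# , coordinate x x′ , coordinate y y′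
    where
    coordinate : ∀ x y → y ≈ 0# * x + 1# * y
    coordinate = solve 2 (λ x y → y := con (+ 0) :* x :+ con (+ 1) :* y) refl

  side-points : ∀ {P : Point → Point → Set} {t} →
                (∀ {u u′ v v′} → u ≈ₚ u′ → v ≈ₚ v′ → P u v → P u′ v′) →
                Any (λ (u , v) → P u v) (sides t) →
                ∃[ a ] ∃[ b ] ∃[ g ] ((a , b) , g) ∈ sides° × P (at t (ιₚ a)) (at t (ιₚ b))
  side-points {t = t} resp (here h) =
    _ , _ , _ , here ≡.refl , resp (≈ₚ.sym (at-right t)) (≈ₚ.sym (at-short t)) h
  side-points {t = t} resp (there (here h)) =
    _ , _ , _ , there (here ≡.refl) , resp (≈ₚ.sym (at-right t)) (≈ₚ.sym (at-long t)) h
  side-points {t = t} resp (there (there (here h))) =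
    _ , _ , _ , there (there (here ≡.refl)) , resp (≈ₚ.sym (at-short t)) (≈ₚ.sym (at-long t)) h

  points-side : ∀ {P : Point → Point → Set} {t a b g} →
                (∀ {u u′ v v′} → u ≈ₚ u′ → v ≈ₚ v′ → P u v → P u′ v′) →
                ((a , b) , g) ∈ sides° → P (at t (ιₚ a)) (at t (ιₚ b)) → Any (λ (u , v) → P u v) (sides t)
  points-side {t = t} resp (here ≡.refl) h = here (resp (at-right t) (at-short t) h)
  points-side {t = t} resp (there (here ≡.refl)) h = there (here (resp (at-right t) (at-long t) h))
  points-side {t = t} resp (there (there (here ≡.refl))) h = there (there (here (resp (at-short t) (at-long t) h)))

  at-mid : ∀ t → StrictlyBetween (at t (ιₚ right°)) (at t (ιₚ long°)) (at t (ιₚ mid°))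
  at-mid t = ½ , ½ , 0<½ , 0<½ , ½+½ , ≈ₚ.sym (≈ₚ.trans (at-line t ½+½ (ιₚ right°) (ιₚ long°)) (at-congʳ t
    ( solve 1 (λ h → h :* con (+ 0) :+ h :* con (+ 0) := con (+ 0)) refl ½
    , trans (solve 1 (λ h → h :* con (+ 0) :+ h :* con (+ 2) := h :+ h) refl ½) ½+½)))
    where
    0<½ : 0# < ½
    0<½ = 0≤½ , λ e → 1≉0 (trans (sym ½+½) (trans (+-cong (sym e) (sym e)) (+-identityˡ 0#)))

  -- Parity of squared distances

  5^ : ℕ → ℤ
  5^ n = (+ 5) ℤ.^ n

  -- The squared distance is an even element of ℤ[1/5].
  EvenDist : Point → Point → Set
  EvenDist p q = ∃[ n ] ∃[ k ] ι (5^ n) * dist² p q ≈ ι (+ 2 ℤ.* k)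

  EvenDist-resp : ∀ {p q q′} → q ≈ₚ q′ → EvenDist p q → EvenDist p q′
  EvenDist-resp e (n , k , h) = n , k , trans (*-congˡ (dist²-cong ≈ₚ.refl (≈ₚ.sym e))) h

  opaque
    -- Comparing the two ways of clearing denominators gives 5^m N = 2 · 5^n k, and 5^m is odd. So
    -- evenness can be tested at the scale of any patch.
    EvenDist⇒Even : ∀ {p q} n N → ι (5^ n) * dist² p q ≈ ι N → EvenDist p q → Even N
    EvenDist⇒Even {p} {q} n N h (m , k , h′) =
      [ (λ even → even)
      , (λ odd → contradiction (odd-* {5^ m} {N} (odd-5^ m) odd) (even⇒¬odd (5^ n ℤ.* k , 5^m*N))) ]′ (even⊎odd N)
      where
      open SetoidReasoning setoid
      swap : ∀ a k → a ℤ.* (+ 2 ℤ.* k) ≡ + 2 ℤ.* (a ℤ.* k)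
      swap = solve-∀
      5^m*N : 5^ m ℤ.* N ≡ + 2 ℤ.* (5^ n ℤ.* k)
      5^m*N = ≡.trans (ι-injective (begin
        ι (5^ m ℤ.* N)                       ≈⟨ ι-* (5^ m) N ⟩
        ι (5^ m) * ι N                       ≈⟨ *-congˡ h ⟨
        ι (5^ m) * (ι (5^ n) * dist² p q)    ≈⟨ solve 3 (λ a b d → a :* (b :* d) := b :* (a :* d)) refl _ _ _ ⟩
        ι (5^ n) * (ι (5^ m) * dist² p q)    ≈⟨ *-congˡ h′ ⟩
        ι (5^ n) * ι (+ 2 ℤ.* k)             ≈⟨ ι-* (5^ n) (+ 2 ℤ.* k) ⟨
        ι (5^ n ℤ.* (+ 2 ℤ.* k))             ∎)) (swap (5^ n) k)

    Even⇒EvenDist : ∀ {p q} n N → ι (5^ n) * dist² p q ≈ ι N → Even N → EvenDist p q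
    Even⇒EvenDist n N h (k , e) = n , k , trans h (reflexive (≡.cong ι e))

  -- Nearness and placement under substitution

  module Substitution (s : Carrier) (s²≈5 : s * s ≈ 5#) where

    dist²-s : ∀ p q → dist² (s · p) (s · q) ≈ 5# * dist² p q
    dist²-s p q = trans (dist²-· s p q) (*-congʳ s²≈5)

    opaque
      -- Before the expansion the same two points are closer by the factor √5, so parents inherit
      -- nearness with the same threshold.
      near-parts : ∀ {t t′ i j} → Near (part s t i) (part s t′ j) → Near t t′
      near-parts {t} {t′} {i} {j} (p , q , p∈K , q∈K , near) =
        _ , _ , piece-InK i p∈K , piece-InK j q∈K ,
        ≤-<-trans (0≤y-x⇒x≤y (0≤-resp
          (solve 1 (λ d → (five :- con (+ 1)) :* (five :* d) := five :* (five :* d) :- five :* d) refl d)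
          (*-nonneg (0≤-resp (solve 0 (con (+ 4) := five :- con (+ 1)) refl) (0≤ι+ 4))
                    (*-nonneg 0≤5 (0≤dist² _ _)))))
        (<-respˡ (*-congˡ (trans (dist²-cong (at-part s t i p) (at-part s t′ j q)) (dist²-s _ _))) near)
        where
        d : Carrier
        d = dist² (at t (⅕ · ⟪ piece i ⟫ p)) (at t′ (⅕ · ⟪ piece j ⟫ q))

    5·5·⅕ : ∀ p q → 5# * (5# * dist² (⅕ · p) (⅕ · q)) ≈ dist² p q
    5·5·⅕ p q = begin
      5# * (5# * dist² (⅕ · p) (⅕ · q))    ≈⟨ *-congˡ (*-congˡ (dist²-· ⅕ p q)) ⟩
      5# * (5# * ((⅕ * ⅕) * dist² p q))    ≈⟨ solve 2 (λ g d → five :* (five :* ((g :* g) :* d)) :=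
                                                       con (+ 5) :* g :* (con (+ 5) :* g) :* d) refl ⅕ _ ⟩
      (ι (+ 5) * ⅕) * (ι (+ 5) * ⅕) * dist² p q ≈⟨ *-congʳ (trans (*-cong 5*⅕ 5*⅕) (*-identityˡ 1#)) ⟩
      1# * dist² p q                       ≈⟨ *-identityˡ _ ⟩
      dist² p q                            ∎
      where open ≈-Reasoning

    part-isometry : ∀ {t} → IsIsometry (at t) → ∀ j → IsIsometry (at (part s t j))
    part-isometry {t} iso j p q = begin
      dist² (at (part s t j) p) (at (part s t j) q)      ≈⟨ dist²-cong (at-part s t j p) (at-part s t j q) ⟩
      dist² (s · at t (⅕ · p′)) (s · at t (⅕ · q′))      ≈⟨ dist²-s _ _ ⟩
      5# * dist² (at t (⅕ · p′)) (at t (⅕ · q′))         ≈⟨ *-congˡ (iso _ _) ⟩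
      5# * dist² (⅕ · p′) (⅕ · q′)                       ≈⟨ *-congˡ (dist²-· ⅕ p′ q′) ⟩
      5# * ((⅕ * ⅕) * dist² p′ q′)                       ≈⟨ *-congˡ (*-congˡ (dist²-piece j p q)) ⟩
      5# * ((⅕ * ⅕) * (5# * dist² p q))                  ≈⟨ solve 2 (λ g d →
        five :* ((g :* g) :* (five :* d)) := five :* (five :* ((g :* g) :* d))) refl ⅕ _ ⟩
      5# * (5# * ((⅕ * ⅕) * dist² p q))                  ≈⟨ *-congˡ (*-congˡ (dist²-· ⅕ p q)) ⟨
      5# * (5# * dist² (⅕ · p) (⅕ · q))                  ≈⟨ 5·5·⅕ p q ⟩
      dist² p q                                          ∎
      where
      open ≈-Reasoning
      p′ = ⟪ piece j ⟫ p
      q′ = ⟪ piece j ⟫ q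

    placed-⅕ : ∀ {ρ t t′} → Placed ρ t t′ → ∀ j p →
               at t′ (⅕ · ⟪ piece j ⟫ p) ≈ₚ at t (⅕ · ⟪ expand ρ ⊚ piece j ⟫ p)
    placed-⅕ {ρ} {t} {t′} placed j p = ≈ₚ.trans (placed _) (at-congʳ t (≈ₚ.trans
      (≈ₚ.sym (⟪expand⟫ ρ (⟪ piece j ⟫ p)))
      (·-congˡ (≈ₚ.sym (⟪⟫-⊚ (expand ρ) (piece j) p)))))

    opaque
      placed-parts : ∀ {ρ ρ′ t t′} i j → Placed ρ t t′ → expand ρ ⊚ piece j ≡ piece i ⊚ ρ′ →
                     Placed ρ′ (part s t i) (part s t′ j)
      placed-parts {ρ} {ρ′} {t} {t′} i j placed eq p = begin
        at (part s t′ j) p                        ≈⟨ at-part s t′ j p ⟩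
        s · at t′ (⅕ · ⟪ piece j ⟫ p)             ≈⟨ ·-congˡ (placed-⅕ {ρ} {t} {t′} placed j p) ⟩
        s · at t (⅕ · ⟪ expand ρ ⊚ piece j ⟫ p)   ≡⟨ ≡.cong (λ τ → s · at t (⅕ · ⟪ τ ⟫ p)) eq ⟩
        s · at t (⅕ · ⟪ piece i ⊚ ρ′ ⟫ p)         ≈⟨ ·-congˡ (at-congʳ t (·-congˡ (⟪⟫-⊚ (piece i) ρ′ p))) ⟩
        s · at t (⅕ · ⟪ piece i ⟫ (⟪ ρ′ ⟫ p))     ≈⟨ at-part s t i (⟪ ρ′ ⟫ p) ⟨
        at (part s t i) (⟪ ρ′ ⟫ p)                ∎
        where open ≈ₚ-Reasoning

    opaque
      far-parts : ∀ {ρ t t′} i j → IsIsometry (at t) → Placed ρ t t′ →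
                  Far (piece i) (expand ρ ⊚ piece j) → ¬ Near (part s t i) (part s t′ j)
      far-parts {ρ} {t} {t′} i j iso placed far (p , q , p∈K , q∈K , near) =
        far-apart {piece i} {expand ρ ⊚ piece j} far p∈K q∈K (<-respˡ (begin
          5# * dist² (at (part s t i) p) (at (part s t′ j) q)
            ≈⟨ *-congˡ (dist²-cong (at-part s t i p) (≈ₚ.trans (at-part s t′ j q)
                 (·-congˡ (placed-⅕ {ρ} {t} {t′} placed j q)))) ⟩
          5# * dist² (s · at t (⅕ · _)) (s · at t (⅕ · _))   ≈⟨ *-congˡ (dist²-s _ _) ⟩
          5# * (5# * dist² (at t (⅕ · _)) (at t (⅕ · _)))    ≈⟨ *-congˡ (*-congˡ (iso _ _)) ⟩
          5# * (5# * dist² (⅕ · _) (⅕ · _))                  ≈⟨ 5·5·⅕ _ _ ⟩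
          dist² (⟪ piece i ⟫ p) (⟪ expand ρ ⊚ piece j ⟫ q)   ∎) near)
        where open ≈-Reasoning

    data Supertile : ℕ → Triangle → Fin 5 → Set where
      -- K has no parent here. Its label is a convention, compatible with the local facts by
      -- `identity-local`.
      root  : Supertile 0 K 1F
      child : ∀ {n t i} → Supertile n t i → ∀ j → Supertile (suc n) (part s t j) j

    at-K : ∀ p → at K p ≈ₚ p
    at-K (x , y) =
      solve 2 (λ x k → baryP (con (+ 0)) (con (+ 1)) (con (+ 0)) x k := x) refl x (y * ½) ,
      trans (solve 2 (λ x k → baryP (con (+ 0)) (con (+ 0)) two x k := k :+ k) refl x (y * ½)) (sym (halve y))

    opaque
      supertile-isometry : ∀ {n t i} → Supertile n t i → IsIsometry (at t)
      supertile-isometry root p q = dist²-cong (at-K p) (at-K q)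
      supertile-isometry (child {t = t} u j) = part-isometry {t} (supertile-isometry u) j

    opaque
      -- Induction on the level: near pieces have near parents, these are placed as one of the
      -- `neighbours`, and `steps` has settled every pair of pieces of such parents.
      supertile-placement : ∀ {n t t′ i j} → Supertile n t i → Supertile n t′ j → Near t t′ →
                            ∃[ ρ ] ρ ∈ neighbours × Local i j ρ × Placed ρ t t′
      supertile-placement root root _ = identity , here ≡.refl , identity-local , λ p → at-congʳ K
        ( solve 2 (λ x y → x := con (+ 0) :+ x :* con (+ 1) :+ y :* con (+ 0)) refl _ _
        , solve 2 (λ x y → y := con (+ 0) :+ x :* con (+ 0) :+ y :* con (+ 1)) refl _ _)
      supertile-placement (child {t = t} u i) (child {t = t′} u′ j) near
        with supertile-placement u u′ (near-parts {t} {t′} {i} {j} near)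
      ... | ρ , ρ∈ , _ , placed with All.lookup steps ρ∈ i j
      ...   | inj₁ far  = contradiction near (far-parts {ρ} {t} {t′} i j (supertile-isometry u) placed far)
      ...   | inj₂ next with find next
      ...     | ρ′ , ρ′∈ , eq , loc = ρ′ , ρ′∈ , loc , placed-parts {ρ} {ρ′} {t} {t′} i j placed eq

    opaque
      ω^-supertile : ∀ {P : Pred Triangle 0ℓ} n → Any P (ω^ s n (K ∷ [])) →
                     ∃[ t ] ∃[ i ] Supertile n t i × P t
      ω^-supertile zero    (here px) = K , 1F , root , px
      ω^-supertile (suc n) h
        with ω^-supertile n (Any.concatMap⁻ (λ t → dissect (mapTriangle (s ·_) t)) h)
      ... | t , i , u , h′ with Any.map⁻ {f = mapTriangle (place (mapTriangle (s ·_) t))} {xs = pieces} h′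
      ...   | h″ = part s t (Any.index h″) , Any.index h″ , child u (Any.index h″) , Any.lookup-index h″

    power : ℕ → Carrier
    power zero    = 1#
    power (suc n) = s * power n

    opaque
      power² : ∀ n → power n * power n ≈ ι ((+ 5) ℤ.^ n)
      power² zero    = *-identityˡ 1#
      power² (suc n) = begin
        (s * power n) * (s * power n)  ≈⟨ solve 2 (λ s p → (s :* p) :* (s :* p) := (s :* s) :* (p :* p)) refl s (power n) ⟩
        (s * s) * (power n * power n)  ≈⟨ *-cong (trans s²≈5 5≈ι5) (power² n) ⟩
        ι (+ 5) * ι ((+ 5) ℤ.^ n)        ≈⟨ ι-* (+ 5) ((+ 5) ℤ.^ n) ⟨
        ι ((+ 5) ℤ.^ suc n)              ∎
        where open ≈-Reasoning

    opaque
      -- At each level `s` enters twice, from the expansion and from `power`, and s² = 5 cancels the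
      -- `⅕` of `at-part`.
      supertile-lattice : ∀ {n t i} → Supertile n t i → ∀ z → ∃[ a ] power n · at t (ιₚ z) ≈ₚ ιₚ a
      supertile-lattice root z = z , ≈ₚ.trans (*-identityˡ _ , *-identityˡ _) (at-K (ιₚ z))
      supertile-lattice {suc n} (child {t = t} u j) z =
        combine (supertile-lattice u right°) (supertile-lattice u (piece j ⟨ z ⟩))
        where
        P : Carrier
        P = power n
        w : ℤ²
        w = piece j ⟨ z ⟩
        ⅕+4⅕ : ⅕ + ι (+ 4) * ⅕ ≈ 1#
        ⅕+4⅕ = trans (solve 1 (λ g → g :+ con (+ 4) :* g := con (+ 5) :* g) refl ⅕) 5*⅕
        -- As `at t` is affine and not linear, w/5 is read as the combination of w and the origin
        -- with weights 1/5 and 4/5; hence the coefficient 4 at `right°`.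
        refined : (s * P) · at (part s t j) (ιₚ z) ≈ₚ P · at t (ιₚ w) +ₚ ι (+ 4) · P · at t (ιₚ right°)
        refined = ≈ₚ.trans (·-congˡ {s * P} (≈ₚ.trans (at-part s t j (ιₚ z)) (·-congˡ {s} (≈ₚ.trans
          (at-congʳ t (≈ₚ.trans (·-congˡ {⅕} (⟪⟫-ιₚ (piece j) z))
            (sym (trans (+-congˡ (zeroʳ _)) (+-identityʳ _)) , sym (trans (+-congˡ (zeroʳ _)) (+-identityʳ _)))))
          (≈ₚ.sym (at-line t ⅕+4⅕ (ιₚ w) (ιₚ right°)))))))
          (coordinate _ _ , coordinate _ _)
          where
          coordinate : ∀ x y → (s * P) * (s * (⅕ * x + (ι (+ 4) * ⅕) * y)) ≈ P * x + ι (+ 4) * (P * y)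
          coordinate x y = begin
            (s * P) * (s * (⅕ * x + (ι (+ 4) * ⅕) * y))
              ≈⟨ solve 5 (λ s P g x y → (s :* P) :* (s :* (g :* x :+ (con (+ 4) :* g) :* y)) :=
                   (s :* s) :* (g :* (P :* x :+ con (+ 4) :* (P :* y)))) refl s P ⅕ x y ⟩
            (s * s) * (⅕ * (P * x + ι (+ 4) * (P * y)))
              ≈⟨ *-congʳ (trans s²≈5 5≈ι5) ⟩
            ι (+ 5) * (⅕ * (P * x + ι (+ 4) * (P * y)))
              ≈⟨ trans (sym (*-assoc _ _ _)) (trans (*-congʳ 5*⅕) (*-identityˡ _)) ⟩
            P * x + ι (+ 4) * (P * y) ∎
            where open ≈-Reasoning
        combine : ∃[ b ] P · at t (ιₚ right°) ≈ₚ ιₚ b → ∃[ a ] P · at t (ιₚ w) ≈ₚ ιₚ a →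
                  ∃[ c ] (s * P) · at (part s t j) (ιₚ z) ≈ₚ ιₚ c
        combine ((b , b′) , eb) ((a , a′) , ea) =
          (a ℤ.+ + 4 ℤ.* b , a′ ℤ.+ + 4 ℤ.* b′) ,
          ≈ₚ.trans refined (sum a b (proj₁ ea) (proj₁ eb) , sum a′ b′ (proj₂ ea) (proj₂ eb))
          where
          sum : ∀ a b {x y} → x ≈ ι a → y ≈ ι b → x + ι (+ 4) * y ≈ ι (a ℤ.+ + 4 ℤ.* b)
          sum a b x y = trans (+-cong x (*-congˡ y))
            (sym (trans (ι-+ a (+ 4 ℤ.* b)) (+-congˡ (ι-* (+ 4) b))))

    -- Patches moved by an isometry

    module _ {n : ℕ} {f : Point → Point} (iso : IsIsometry f) where

      Located : Triangle → Fin 5 → Set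
      Located t i = ∃[ u ] Supertile n u i × t ≈△ mapTriangle f u

      opaque
        located-at : ∀ {t u i} → Supertile n u i → t ≈△ mapTriangle f u → ∀ p → at t p ≈ₚ f (at u p)
        located-at {t} {u} su t≈fu p = ≈ₚ.sym (≈ₚ.trans
          (isometry-affine {λ x → f (at u x)} (λ x y → trans (iso _ _) (supertile-isometry su x y)) p)
          (at-cong {_} {t} (corner (proj₁ (at-corners u)) (proj₁ t≈fu) ,
                            corner (proj₁ (proj₂ (at-corners u))) (proj₁ (proj₂ t≈fu)) ,
                            corner (proj₂ (proj₂ (at-corners u))) (proj₂ (proj₂ t≈fu))) ≈ₚ.refl))
          where
          corner : ∀ {x y c} → x ≈ₚ y → c ≈ₚ f y → f x ≈ₚ c
          corner e e′ = ≈ₚ.trans (isometry-cong iso e) (≈ₚ.sym e′)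

      opaque
        located-placement : ∀ {t t′ i j} → Located t i → Located t′ j → Near t t′ →
                            ∃[ ρ ] Local i j ρ × Placed ρ t t′
        located-placement {t} {t′} {i} {j} (u , su , e) (u′ , su′ , e′) (p , q , p∈K , q∈K , near) =
          lift (supertile-placement su su′ (p , q , p∈K , q∈K , <-respˡ (*-congˡ (trans
            (dist²-cong (located-at {t} su e p) (located-at {t′} su′ e′ q)) (iso _ _))) near))
          where
          lift : ∃[ ρ ] ρ ∈ neighbours × Local i j ρ × Placed ρ u u′ → ∃[ ρ ] Local i j ρ × Placed ρ t t′
          lift (ρ , _ , loc , placed) = ρ , loc , λ p → ≈ₚ.trans (located-at {t′} su′ e′ p)
            (≈ₚ.trans (isometry-cong iso (placed p)) (≈ₚ.sym (located-at {t} su e (⟪ ρ ⟫ p))))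

      located-labelling : Labelling
      located-labelling = record
        { Label = Located
        ; placement = λ {t} {t′} → located-placement {t} {t′}
        ; scale = n
        -- Grid coordinates are taken in the unmoved patch, enlarged by the n-th power of √5.
        ; Grid = λ p a → ∃[ x ] p ≈ₚ f x × power n · x ≈ₚ ιₚ a
        ; grid-dist² = λ { {p} {q} {a} {b} (x , p≈ , ea) (y , q≈ , eb) → trans
            (*-cong (sym (power² n)) (trans (dist²-cong p≈ q≈) (iso x y)))
            (trans (sym (dist²-· (power n) x y)) (trans (dist²-cong ea eb) (dist²-ιₚ a b))) }
        ; grid-lattice = λ { {t} (u , su , e) z → let (a , ea) = supertile-lattice su z in
            a , at u (ιₚ z) , located-at {t} su e (ιₚ z) , ea }
        }

    opaque
      labelling : ∀ {T} → IsRationalPinwheelTiling s T → ∀ ts → All T ts →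
                  Σ[ L ∈ Labelling ] All (λ t → ∃[ i ] Labelling.Label L t i) ts
      labelling tiling ts ts⊆T =
        let (n , f , iso , located) = IsRationalPinwheelTiling.patches tiling ts ts⊆T in
        located-labelling {n} {f} iso ,
        All.map (λ {t} h →
          let (u , i , su , e) = ω^-supertile {λ u → t ≈△ mapTriangle f u} n h in i , u , su , e)
          located

    -- Local structure of a tiling

    module Tiling (T : Pred Triangle 0ℓ) (tiling : IsRationalPinwheelTiling s T) where
      open IsRationalPinwheelTiling tiling using (isTiling)
      open IsTiling isTiling using (covers; tiles)

      opaque
        iso : ∀ {t} → T t → IsIsometry (at t)
        iso t∈T = tile-isometry (tiles t∈T)

      opaque
        at-injective : ∀ {t} → T t → ∀ {p q} → at t p ≈ₚ at t q → p ≈ₚ q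
        at-injective {t} t∈T = isometry-injective {at t} (iso t∈T)

      IsVertexT : Point → Set
      IsVertexT = IsVertex T

      opaque
        vertex-corner : ∀ {p} → IsVertexT p → ∃[ t ] ∃[ c ] T t × c ∈ corners° × p ≈ₚ at t (ιₚ c)
        vertex-corner (t , t∈T , here e)                 = t , right° , t∈T , right∈ , ≈ₚ.trans e (≈ₚ.sym (at-right t))
        vertex-corner (t , t∈T , there (here e))         = t , short° , t∈T , short∈ , ≈ₚ.trans e (≈ₚ.sym (at-short t))
        vertex-corner (t , t∈T , there (there (here e))) = t , long° , t∈T , long∈ , ≈ₚ.trans e (≈ₚ.sym (at-long t))

      opaque
        corner-vertex : ∀ {t c p} → T t → c ∈ corners° → p ≈ₚ at t (ιₚ c) → IsVertexT p
        corner-vertex {t} t∈T (here ≡.refl) e = t , t∈T , here (≈ₚ.trans e (at-right t))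
        corner-vertex {t} t∈T (there (here ≡.refl)) e = t , t∈T , there (here (≈ₚ.trans e (at-short t)))
        corner-vertex {t} t∈T (there (there (here ≡.refl))) e = t , t∈T , there (there (here (≈ₚ.trans e (at-long t))))

      opaque
        placed-ι : ∀ {ρ t t′} → T t → Placed ρ t t′ → ∀ z w → at t (ιₚ w) ≈ₚ at t′ (ιₚ z) → ρ ⟨ z ⟩ ≡ w
        placed-ι {ρ} t∈T placed z w e = ιₚ-injective (≈ₚ.sym (≈ₚ.trans
          (at-injective t∈T (≈ₚ.trans e (placed (ιₚ z)))) (⟪⟫-ιₚ ρ z)))

      opaque
        placed-at : ∀ {ρ t t′} → Placed ρ t t′ → ∀ z {w} → ρ ⟨ z ⟩ ≡ w → at t′ (ιₚ z) ≈ₚ at t (ιₚ w)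
        placed-at {ρ} {t} placed z ≡.refl = ≈ₚ.trans (placed (ιₚ z)) (at-congʳ t (⟪⟫-ιₚ ρ z))

      opaque
        -- In a common patch the tile and a tile with corner w share a lattice.
        vertex-lattice : ∀ {t w x} → T t → IsVertexT w → w ≈ₚ at t x → InK x →
                         ∃[ z ] z ∈ latticePoints × x ≈ₚ ιₚ z
        vertex-lattice {t} {w} {x} t∈T w∈V w≈ x∈K with vertex-corner w∈V
        ... | t′ , c , t′∈T , c∈ , w≈′ with labelling tiling (t ∷ t′ ∷ []) (t∈T ∷ t′∈T ∷ [])
        ...   | L , (i , ℓ) ∷ (j , ℓ′) ∷ []
          with Labelling.placement L ℓ ℓ′
                 (near-point {t} {t′} x∈K (corner-InK c∈) (≈ₚ.trans (≈ₚ.sym w≈) w≈′))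
        ...     | ρ , _ , placed = ρ ⟨ c ⟩ , lattice-K (InK-ι (InK-resp x≈ x∈K)) , x≈
          where
          x≈ : x ≈ₚ ιₚ (ρ ⟨ c ⟩)
          x≈ = ≈ₚ.trans (at-injective t∈T (≈ₚ.trans (≈ₚ.sym w≈) (≈ₚ.trans w≈′ (placed (ιₚ c))))) (⟪⟫-ιₚ ρ c)

        -- Covering supplies a tile through the probe without telling how it lies. The anchor, a
        -- point of `t` close by, makes it `Near`, which is what `placement` asks for.
        probe : ∀ {t a} z → T t → Anchor z a → ∃[ t′ ] T t′ × Near t t′ × ∃[ q ] InK q × at t (quarter z) ≈ₚ at t′ q
        probe {t} {a} z t∈T anchor with covers (at t (quarter z))
        ... | t′ , t′∈T , z∈t′ with inTriangle⇒InK {t′} z∈t′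
        ...   | q , q∈K , e = t′ , t′∈T ,
          (quarter a , q , quarter-InK (proj₂ anchor) , q∈K , <-respˡ (*-congˡ (trans
            (sym (iso t∈T (quarter a) (quarter z))) (dist²-cong ≈ₚ.refl e))) (near-probe {z} {a} anchor)) ,
          q , q∈K , e

        probe-inside : ∀ {ρ t t′ z q} → T t → Placed ρ t t′ → InK q → at t (quarter z) ≈ₚ at t′ q → ¬ Outside z ρ
        probe-inside {ρ} {t} {t′} {z} {q} t∈T placed q∈K e out =
          outside⇒∉ {z} {ρ} out q∈K (at-injective t∈T (≈ₚ.trans e (placed q)))

      opaque
        acrossMid-anchor : Anchor acrossMid (+ 0 , + 4)
        acrossMid-anchor = toWitness {a? = anchor? acrossMid (+ 0 , + 4)} _

      opaque
        acrossShort-anchor : Anchor acrossShort (+ 1 , + 0)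
        acrossShort-anchor = toWitness {a? = anchor? acrossShort (+ 1 , + 0)} _

      opaque
        reversed-near : ∀ {t t′} → Reversed t t′ → Near t t′
        reversed-near {t} {t′} (e , _) = near-point {t} {t′} (corner-InK long∈) (corner-InK right∈)
          (≈ₚ.trans (at-long t) (≈ₚ.trans (≈ₚ.sym e) (≈ₚ.sym (at-right t′))))

      Reverses⇒Reversed : ∀ {ρ t t′} → Placed ρ t t′ → Reverses ρ → Reversed t t′
      Reverses⇒Reversed {ρ} {t} {t′} placed (e , e′) =
        ≈ₚ.trans (≈ₚ.sym (at-right t′)) (≈ₚ.trans (placed-at {ρ} {t} {t′} placed right° e) (at-long t)) ,
        ≈ₚ.trans (≈ₚ.sym (at-long t′)) (≈ₚ.trans (placed-at {ρ} {t} {t′} placed long° e′) (at-right t))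

      Reversed⇒Reverses : ∀ {ρ t t′} → T t → Placed ρ t t′ → Reversed t t′ → Reverses ρ
      Reversed⇒Reverses {ρ} {t} {t′} t∈T placed (e , e′) =
        placed-ι {ρ} {t} {t′} t∈T placed right° long°
          (≈ₚ.trans (at-long t) (≈ₚ.trans (≈ₚ.sym e) (≈ₚ.sym (at-right t′)))) ,
        placed-ι {ρ} {t} {t′} t∈T placed long° right°
          (≈ₚ.trans (at-right t) (≈ₚ.trans (≈ₚ.sym e′) (≈ₚ.sym (at-long t′))))

      mid : Triangle → Point
      mid t = at t (ιₚ mid°)

      module _ (L : Labelling) where
        open Labelling L

        opaque
          reversed-labels : ∀ {t t′ i j} → T t → Label t i → Label t′ j → Reversed t t′ →
                            (i ≡ 1F × j ≡ 3F) ⊎ (i ≡ 3F × j ≡ 1F)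
          reversed-labels {t} {t′} t∈T ℓ ℓ′ rev with placement ℓ ℓ′ (reversed-near {t} {t′} rev)
          ... | ρ , loc , placed = Local.reverse-paired loc (Reversed⇒Reverses {ρ} {t} {t′} t∈T placed rev)

          reversed-paired : ∀ {t t′ i j} → T t → Label t i → Label t′ j → Reversed t t′ → Paired i
          reversed-paired {t} {t′} t∈T ℓ ℓ′ rev =
            [ (λ e → inj₁ (proj₁ e)) , (λ e → inj₂ (proj₁ e)) ]′ (reversed-labels {t} {t′} t∈T ℓ ℓ′ rev)

          acrossMid-cases : ∀ {t t′ i j q} → T t → T t′ → Label t i → Label t′ j → Near t t′ → InK q →
                            at t (quarter acrossMid) ≈ₚ at t′ q →
                            Reversed t t′ ⊎ (IsVertexT (mid t) × ¬ Paired i)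
          acrossMid-cases {t} {t′} {i} {j} {q} t∈T t′∈T ℓ ℓ′ near q∈K e with placement ℓ ℓ′ near
          ... | ρ , loc , placed with Local.across-mid loc
          ...   | inj₁ out = contradiction out (probe-inside {ρ} {t} {t′} t∈T placed q∈K e)
          ...   | inj₂ (inj₁ rev) = inj₁ (Reverses⇒Reversed {ρ} {t} {t′} placed rev)
          ...   | inj₂ (inj₂ mc) with find mc
          ...     | c , c∈ , ρc≡mid = inj₂
            ( corner-vertex {t′} t′∈T c∈ (≈ₚ.sym (placed-at {ρ} {t} {t′} placed c ρc≡mid))
            , λ paired → Local.paired-mid loc paired mc)

          acrossShort-mid : ∀ {t t′ j q} → T t → Label t 1F → Label t′ j → Near t t′ → InK q →
                            at t (quarter acrossShort) ≈ₚ at t′ q → mid t′ ≈ₚ right t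
          acrossShort-mid {t} {t′} {j} {q} t∈T ℓ ℓ′ near q∈K e with placement ℓ ℓ′ near
          ... | ρ , loc , placed with Local.across-short loc ≡.refl
          ...   | inj₁ out = contradiction out (probe-inside {ρ} {t} {t′} t∈T placed q∈K e)
          ...   | inj₂ ρm≡r = ≈ₚ.trans (placed-at {ρ} {t} {t′} placed mid° ρm≡r) (at-right t)

          paired-probe : ∀ {t t′ i j q} → T t → Label t i → Label t′ j → Near t t′ → InK q →
                         at t (quarter (pairedProbe i)) ≈ₚ at t′ q → Paired j
          paired-probe {t} {t′} {i} {j} {q} t∈T ℓ ℓ′ near q∈K e with placement ℓ ℓ′ near
          ... | ρ , loc , placed with Local.probe-paired loc
          ...   | inj₁ out = contradiction out (probe-inside {ρ} {t} {t′} t∈T placed q∈K e)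
          ...   | inj₂ paired = paired

          mid-right-label : ∀ {t t′ i j} → T t → Label t i → Label t′ j → Paired i → mid t′ ≈ₚ right t → i ≡ 1F
          mid-right-label {t} {t′} t∈T ℓ ℓ′ paired e
            with placement ℓ ℓ′ (near-point {t} {t′} (corner-InK right∈) mid-InK
                   (≈ₚ.trans (at-right t) (≈ₚ.sym e)))
          ... | ρ , loc , placed = Local.mid-right loc paired
            (placed-ι {ρ} {t} {t′} t∈T placed mid° right° (≈ₚ.trans (at-right t) (≈ₚ.sym e)))

          right-tip-label : ∀ {t t′ i z} → T t → Label t i → Label t′ 1F → z ∈ latticePoints → InK (ιₚ z) →
                            at t (ιₚ z) ≈ₚ right t′ → z ≡ tip i
          right-tip-label {t} {t′} {i} {z} t∈T ℓ ℓ′ z∈ z∈K e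
            with placement ℓ ℓ′ (near-point {t} {t′} z∈K (corner-InK right∈)
                   (≈ₚ.trans e (≈ₚ.sym (at-right t′))))
          ... | ρ , loc , placed = ≡.trans (≡.sym ρr≡z)
            (Local.right-tip loc ≡.refl (≡.subst (_∈ latticePoints) (≡.sym ρr≡z) z∈))
            where
            ρr≡z : ρ ⟨ right° ⟩ ≡ z
            ρr≡z = placed-ι {ρ} {t} {t′} t∈T placed right° z (≈ₚ.trans e (≈ₚ.sym (at-right t′)))

      opaque
        -- The dichotomy of divided and undivided long legs, free of labels: the tile just beyond
        -- the midpoint has either a corner there or the same long leg. `reversed-mid` makes the
        -- cases exclusive.
        mid-vertex⊎reversed : ∀ {t} → T t → IsVertexT (mid t) ⊎ (∃[ t′ ] T t′ × Reversed t t′)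
        mid-vertex⊎reversed {t} t∈T with probe {t} acrossMid t∈T acrossMid-anchor
        ... | t′ , t′∈T , near , q , q∈K , e with labelling tiling (t ∷ t′ ∷ []) (t∈T ∷ t′∈T ∷ [])
        ...   | L , (i , ℓ) ∷ (j , ℓ′) ∷ [] =
          [ (λ rev → inj₂ (t′ , t′∈T , rev)) , (λ m → inj₁ (proj₁ m)) ]′
          (acrossMid-cases L {t} {t′} t∈T t′∈T ℓ ℓ′ near q∈K e)

      opaque
        reversed-mid : ∀ {t t′} → T t → T t′ → Reversed t t′ → ¬ IsVertexT (mid t)
        reversed-mid {t} {t′} t∈T t′∈T rev m∈V with vertex-corner m∈V
        ... | u , c , u∈T , c∈ , m≈ with labelling tiling (t ∷ t′ ∷ u ∷ []) (t∈T ∷ t′∈T ∷ u∈T ∷ [])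
        ...   | L , (i , ℓ) ∷ (j , ℓ′) ∷ (k , ℓ″) ∷ []
          with Labelling.placement L ℓ ℓ″ (near-point {t} {u} mid-InK (corner-InK c∈) m≈)
        ...     | ρ , loc , placed = Local.paired-mid loc (reversed-paired L {t} {t′} t∈T ℓ ℓ′ rev)
          (lose c∈ (placed-ι {ρ} {t} {u} t∈T placed c mid° m≈))

      -- Describes without labels the interior vertex (1,0) of a dissected parent: the midpoint of
      -- the long leg of the first piece and the right angle of the second, which shares its long
      -- leg with the fourth. The midpoint clause breaks the symmetry between the second and the
      -- fourth.
      Special : Point → Set
      Special v = ∃[ t₁ ] ∃[ t₂ ] ∃[ t₃ ] T t₁ × T t₂ × T t₃ × v ≈ₚ mid t₁ × v ≈ₚ right t₂ × Reversed t₂ t₃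

      Special-resp : ∀ {v w} → v ≈ₚ w → Special v → Special w
      Special-resp e (t₁ , t₂ , t₃ , T₁ , T₂ , T₃ , m , r , rev) =
        t₁ , t₂ , t₃ , T₁ , T₂ , T₃ , ≈ₚ.trans (≈ₚ.sym e) m , ≈ₚ.trans (≈ₚ.sym e) r , rev

      opaque
        -- Only labels tell which tile is the second piece, so tiles beyond both short legs are
        -- fetched before the patch is chosen. Beyond the short leg of the second piece,
        -- `across-short` finds the required midpoint.
        reversed-special : ∀ {t t′} → T t → T t′ → Reversed t t′ → Special (right t) ⊎ Special (right t′)
        reversed-special {t} {t′} t∈T t′∈T rev
          with probe {t} acrossShort t∈T acrossShort-anchor | probe {t′} acrossShort t′∈T acrossShort-anchor
        ... | u , u∈T , near , q , q∈K , e | u′ , u′∈T , near′ , q′ , q′∈K , e′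
          with labelling tiling (t ∷ t′ ∷ u ∷ u′ ∷ []) (t∈T ∷ t′∈T ∷ u∈T ∷ u′∈T ∷ [])
        ... | L , (i , ℓ) ∷ (j , ℓ′) ∷ (k , ℓ″) ∷ (k′ , ℓ‴) ∷ [] with reversed-labels L {t} {t′} t∈T ℓ ℓ′ rev
        ...   | inj₁ (≡.refl , _) = inj₁ (u , t , t′ , u∈T , t∈T , t′∈T ,
                  ≈ₚ.sym (acrossShort-mid L {t} {u} t∈T ℓ ℓ″ near q∈K e) , ≈ₚ.refl , rev)
        ...   | inj₂ (_ , ≡.refl) = inj₂ (u′ , t′ , t , u′∈T , t′∈T , t∈T ,
                  ≈ₚ.sym (acrossShort-mid L {t′} {u′} t′∈T ℓ′ ℓ‴ near′ q′∈K e′) , ≈ₚ.refl , Reversed-sym {t} {t′} rev)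

        -- Sharing a long leg gives `t₂` the label `1F` or `3F`, and a midpoint at its right angle
        -- leaves `1F`. So `v` is the right angle of a second piece, which `right-tip` allows only
        -- at the `tip` of `t`.
        special-tip : ∀ (L : Labelling) {t i z v} → T t → Labelling.Label L t i →
                      z ∈ latticePoints → InK (ιₚ z) → v ≈ₚ at t (ιₚ z) →
                      ((t₁ , t₂ , t₃ , _) : Special v) → ∃ (Labelling.Label L t₁) →
                      ∃ (Labelling.Label L t₂) → ∃ (Labelling.Label L t₃) → z ≡ tip i
        special-tip L {t} {i} {z} t∈T ℓ z∈ z∈K v≈
          (t₁ , t₂ , t₃ , T₁ , T₂ , T₃ , m , r , rev) (_ , ℓ₁) (j , ℓ₂) (_ , ℓ₃)
          with mid-right-label L {t₂} {t₁} T₂ ℓ₂ ℓ₁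
                 (reversed-paired L {t₂} {t₃} T₂ ℓ₂ ℓ₃ rev) (≈ₚ.trans (≈ₚ.sym m) r)
        ... | ≡.refl = right-tip-label L {t} {t₂} {z = z} t∈T ℓ ℓ₂ z∈ z∈K (≈ₚ.trans (≈ₚ.sym v≈) r)

        -- `tip i` depends only on the label of `t`, so in a patch containing all witnesses of both
        -- points they sit at the same place of `t`. This is why adjacent vertices never both get
        -- the third colour.
        specials-coincide : ∀ {t z w v v′} → T t → z ∈ latticePoints → w ∈ latticePoints → InK (ιₚ z) → InK (ιₚ w) →
                            v ≈ₚ at t (ιₚ z) → v′ ≈ₚ at t (ιₚ w) → Special v → Special v′ → z ≡ w
        specials-coincide {t} {z} {w} t∈T z∈ w∈ z∈K w∈K v≈ v′≈
          sv@(t₁ , t₂ , t₃ , T₁ , T₂ , T₃ , _) sw@(u₁ , u₂ , u₃ , U₁ , U₂ , U₃ , _)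
          with labelling tiling (t ∷ t₁ ∷ t₂ ∷ t₃ ∷ u₁ ∷ u₂ ∷ u₃ ∷ []) (t∈T ∷ T₁ ∷ T₂ ∷ T₃ ∷ U₁ ∷ U₂ ∷ U₃ ∷ [])
        ... | L , (i , ℓ) ∷ l₁ ∷ l₂ ∷ l₃ ∷ m₁ ∷ m₂ ∷ m₃ ∷ [] =
          ≡.trans (special-tip L {t} {z = z} t∈T ℓ z∈ z∈K v≈ sv l₁ l₂ l₃)
                  (≡.sym (special-tip L {t} {z = w} t∈T ℓ w∈ w∈K v′≈ sw m₁ m₂ m₃))

        -- The probe that leads to a paired tile depends on the still unknown label of `t`. So all
        -- five probes are covered, and for each tile found also the point beyond its long leg; the
        -- label of `t` in the patch then selects the index.
        reversed-exists : ∃[ t ] ∃[ t′ ] T t × T t′ × Reversed t t′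
        reversed-exists with covers (0# , 0#)
        ... | t , t∈T , _ = search (labelling tiling (t ∷ List.tabulate x List.++ List.tabulate y)
                (t∈T ∷ All.++⁺ (All.tabulate⁺ x∈T) (All.tabulate⁺ y∈T)))
          where
          px : ∀ i → ∃[ t′ ] T t′ × Near t t′ × ∃[ q ] InK q × at t (quarter (pairedProbe i)) ≈ₚ at t′ q
          px i = probe {t} (pairedProbe i) t∈T (paired-anchored i)
          x y : Fin 5 → Triangle
          x i = proj₁ (px i)
          x∈T : ∀ i → T (x i)
          x∈T i = proj₁ (proj₂ (px i))
          py : ∀ i → ∃[ t′ ] T t′ × Near (x i) t′ × ∃[ q ] InK q × at (x i) (quarter acrossMid) ≈ₚ at t′ q
          py i = probe {x i} acrossMid (x∈T i) acrossMid-anchor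
          y i = proj₁ (py i)
          y∈T : ∀ i → T (y i)
          y∈T i = proj₁ (proj₂ (py i))
          search : Σ[ L ∈ Labelling ] All (λ t → ∃ (Labelling.Label L t)) (t ∷ List.tabulate x List.++ List.tabulate y) →
                   ∃[ t ] ∃[ t′ ] T t × T t′ × Reversed t t′
          search (L , (i , ℓ) ∷ ℓs) =
            let (_ , _ , near , q , q∈K , e) = px i
                (_ , _ , near′ , q′ , q′∈K , e′) = py i
                (j , ℓx) = All.tabulate⁻ {f = x} (All.++⁻ˡ (List.tabulate x) ℓs) i
                (k , ℓy) = All.tabulate⁻ {f = y} (All.++⁻ʳ (List.tabulate x) ℓs) i
                paired = paired-probe L {t} {x i} t∈T ℓ ℓx near q∈K e
            in [ (λ rev → x i , y i , x∈T i , y∈T i , rev) , (λ m → contradiction paired (proj₂ m)) ]′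
               (acrossMid-cases L {x i} {y i} (x∈T i) (y∈T i) ℓx ℓy near′ q′∈K e′)

      -- Edges of the graph

      EdgeStep : Point → Point → Set
      EdgeStep p q = ∃[ t ] ∃[ z ] ∃[ w ] T t × z ∈ latticePoints × w ∈ latticePoints ×
        InK (ιₚ z) × InK (ιₚ w) × p ≈ₚ at t (ιₚ z) × q ≈ₚ at t (ιₚ w) × z ≢ w × Step° z w

      opaque
        -- A side is recorded by the value of `g` on it, which turns incidence into the integral
        -- condition tested by `side-step` and `side-between`.
        vertex-on-side : ∀ {t a b g p} → T t → ((a , b) , g) ∈ sides° → IsVertexT p →
                         ∀ {α β} → 0# ≤ α → 0# ≤ β → α + β ≈ 1# → p ≈ₚ α · at t (ιₚ a) +ₚ β · at t (ιₚ b) →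
                         ∃[ z ] z ∈ latticePoints × InK (ιₚ z) × p ≈ₚ at t (ιₚ z) × g • z ≡ g • a ×
                                α · ιₚ a +ₚ β · ιₚ b ≈ₚ ιₚ z
        vertex-on-side {t} {a} {b} {g} {p} t∈T side∈ p∈V {α} {β} 0≤α 0≤β sum p≈ with All.lookup side-corners side∈
        ... | a∈ , b∈ , a≢b , ga≡gb with vertex-lattice {t} {p} {α · ιₚ a +ₚ β · ιₚ b} t∈T p∈V
               (≈ₚ.trans p≈ (at-line t sum (ιₚ a) (ιₚ b)))
               (InK-line (corner-InK a∈) (corner-InK b∈) 0≤α 0≤β sum)
        ...   | z , z∈ , x≈ = z , z∈ , InK-resp x≈ (InK-line (corner-InK a∈) (corner-InK b∈) 0≤α 0≤β sum) ,
          ≈ₚ.trans p≈ (≈ₚ.trans (at-line t sum (ιₚ a) (ιₚ b)) (at-congʳ t x≈)) ,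
          ι-injective (trans (sym (dot-ι g z)) (trans (dot-cong g (≈ₚ.sym x≈)) on-line)) , x≈
          where
          on-line : dot g (α · ιₚ a +ₚ β · ιₚ b) ≈ ι (g • a)
          on-line = trans (dot-line g α β (ιₚ a) (ιₚ b)) (trans
            (+-cong (*-congˡ (dot-ι g a)) (*-congˡ (trans (dot-ι g b) (reflexive (≡.cong ι (≡.sym ga≡gb))))))
            (trans (sym (distribʳ (ι (g • a)) α β)) (trans (*-congʳ sum) (*-identityˡ _))))

        vertex-between : ∀ {t a b g w} → T t → ((a , b) , g) ∈ sides° → IsVertexT w →
                         StrictlyBetween (at t (ιₚ a)) (at t (ιₚ b)) w → w ≈ₚ mid t × a ≡ right° × b ≡ long°
        vertex-between {t} {a} {b} {g} {w} t∈T side∈ w∈V (α , β , (0≤α , 0≉α) , (0≤β , 0≉β) , sum , w≈) =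
          let (z , z∈ , _ , w≈z , gz≡ga , x≈) = vertex-on-side {t} {a} {b} {g} {w} t∈T side∈ w∈V 0≤α 0≤β sum w≈
          in cases z w≈z x≈ (All.lookup (All.lookup side-between side∈) z∈ gz≡ga)
          where
          a≢b : a ≢ b
          a≢b = proj₁ (proj₂ (proj₂ (All.lookup side-corners side∈)))
          cases : ∀ z → w ≈ₚ at t (ιₚ z) → α · ιₚ a +ₚ β · ιₚ b ≈ₚ ιₚ z →
                  z ≡ a ⊎ z ≡ b ⊎ (z ≡ mid° × a ≡ right° × b ≡ long°) → w ≈ₚ mid t × a ≡ right° × b ≡ long°
          cases z w≈z x≈ (inj₁ z≡a) = contradiction (ιₚ-injective {a} {b}
            (≈ₚ.sym (line-end {α} {β} sum (λ e → 0≉β (sym e)) (ιₚ a) (ιₚ b)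
              (≈ₚ.trans x≈ (≈ₚ.reflexive (≡.cong ιₚ z≡a)))))) a≢b
          cases z w≈z x≈ (inj₂ (inj₁ z≡b)) = contradiction (ιₚ-injective {a} {b}
            (line-end {β} {α} (trans (+-comm β α) sum) (λ e → 0≉α (sym e)) (ιₚ b) (ιₚ a)
              (≈ₚ.trans (+-comm _ _ , +-comm _ _) (≈ₚ.trans x≈ (≈ₚ.reflexive (≡.cong ιₚ z≡b)))))) a≢b
          cases z w≈z x≈ (inj₂ (inj₂ (z≡m , a≡ , b≡))) =
            ≈ₚ.trans w≈z (≈ₚ.reflexive (≡.cong (λ z → at t (ιₚ z)) z≡m)) , a≡ , b≡

        side-edge : ∀ {t a b g} → T t → ((a , b) , g) ∈ sides° → (a ≡ right° → b ≡ long° → ¬ IsVertexT (mid t)) →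
                    IsEdge T (at t (ιₚ a)) (at t (ιₚ b))
        side-edge {t} {a} {b} {g} t∈T side∈ gap =
          (λ e → proj₁ (proj₂ (proj₂ (All.lookup side-corners side∈))) (ιₚ-injective {a} {b} (at-injective t∈T e))) ,
          (t , t∈T , points-side {λ u v → OnSegment u v (at t (ιₚ a)) × OnSegment u v (at t (ιₚ b))} {t}
            (λ e e′ (h , h′) → onSegment-resp e e′ h , onSegment-resp e e′ h′)
            side∈ (startOnSegment _ _ , endOnSegment _ _)) ,
          λ w w∈V between → let (w≈m , a≡ , b≡) = vertex-between {t} {a} {b} {g} {w} t∈T side∈ w∈V between in
            gap a≡ b≡ (vertex-resp w≈m w∈V)
          where
          vertex-resp : ∀ {v w} → v ≈ₚ w → IsVertexT v → IsVertexT w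
          vertex-resp e (t , t∈T , h) = t , t∈T , Any.map (≈ₚ.trans (≈ₚ.sym e)) h

        edge-step : ∀ {p q} → IsVertexT p → IsVertexT q → IsEdge T p q → EdgeStep p q
        edge-step {p} {q} p∈V q∈V (p≉q , (t , t∈T , on) , _) =
          on-side (side-points {λ u v → OnSegment u v p × OnSegment u v q} {t}
            (λ e e′ (h , h′) → onSegment-resp e e′ h , onSegment-resp e e′ h′) on)
          where
          Position : ℤ² → ℤ² → Point → Set
          Position a g p = ∃[ z ] z ∈ latticePoints × InK (ιₚ z) × p ≈ₚ at t (ιₚ z) × g • z ≡ g • a
          position : ∀ {a b g p} → ((a , b) , g) ∈ sides° → IsVertexT p →
                     OnSegment (at t (ιₚ a)) (at t (ιₚ b)) p → Position a g p
          position {a} {b} {g} {p} side∈ p∈V (_ , _ , 0≤α , 0≤β , sum , p≈) =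
            let (z , z∈ , z∈K , p≈z , gz , _) = vertex-on-side {t} {a} {b} {g} {p} t∈T side∈ p∈V 0≤α 0≤β sum p≈
            in z , z∈ , z∈K , p≈z , gz
          steps-apart : ∀ {a b g} → ((a , b) , g) ∈ sides° → Position a g p → Position a g q → EdgeStep p q
          steps-apart side∈ (z , z∈ , z∈K , p≈ , gz) (w , w∈ , w∈K , q≈ , gw) =
            t , z , w , t∈T , z∈ , w∈ , z∈K , w∈K , p≈ , q≈ , z≢w ,
            [ (λ z≡w → contradiction z≡w z≢w) , (λ step → step) ]′
            (All.lookup (All.lookup (All.lookup side-step side∈) z∈) w∈ gz gw)
            where
            z≢w : z ≢ w
            z≢w z≡w = p≉q (≈ₚ.trans p≈ (≈ₚ.trans (≈ₚ.reflexive (≡.cong (λ z → at t (ιₚ z)) z≡w)) (≈ₚ.sym q≈)))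
          on-side : ∃[ a ] ∃[ b ] ∃[ g ] ((a , b) , g) ∈ sides° ×
                    (OnSegment (at t (ιₚ a)) (at t (ιₚ b)) p × OnSegment (at t (ιₚ a)) (at t (ιₚ b)) q) →
                    EdgeStep p q
          on-side (a , b , g , side∈ , h , h′) =
            steps-apart {a} {b} {g} side∈ (position {a} {b} {g} {p} side∈ p∈V h) (position {a} {b} {g} {q} side∈ q∈V h′)

        -- An edge has no vertex at its midpoint, so the leg is undivided and `reversed-special`
        -- applies to its two ends.
        long-leg-special : ∀ {t p q} → T t → p ≈ₚ at t (ιₚ right°) → q ≈ₚ at t (ιₚ long°) →
                           IsEdge T p q → Special p ⊎ Special q
        long-leg-special {t} {p} {q} t∈T p≈ q≈ (_ , _ , none) with mid-vertex⊎reversed t∈T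
        ... | inj₁ m∈V = contradiction (betweenSegment-resp (≈ₚ.sym p≈) (≈ₚ.sym q≈) (at-mid t)) (none (mid t) m∈V)
        ... | inj₂ (t′ , t′∈T , rev) =
          [ (λ h → inj₁ (Special-resp (≈ₚ.trans (≈ₚ.sym (at-right t)) (≈ₚ.sym p≈)) h))
          , (λ h → inj₂ (Special-resp (≈ₚ.trans (proj₁ rev) (≈ₚ.trans (≈ₚ.sym (at-long t)) (≈ₚ.sym q≈))) h)) ]′
          (reversed-special {t} {t′} t∈T t′∈T rev)

      -- Parity colouring and the chromatic number

      opaque
        base-tile : ∃ T
        base-tile = let (t , t∈T , _) = IsTiling.covers (IsRationalPinwheelTiling.isTiling tiling) (0# , 0#) in t , t∈T

      base : Point
      base = at (proj₁ base-tile) (ιₚ right°)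

      EvenVertex : Point → Set
      EvenVertex = EvenDist base

      opaque
        -- On the grid of a common patch, `base` and the two points form a triangle whose squared
        -- sides have an even sum, and the squared side between the points is a power of 5 times an
        -- odd number. So exactly one of the other two is odd.
        odd-step-parity : ∀ {t z w} → T t → Odd (dist²ℤ z w) →
          ¬ (EvenVertex (at t (ιₚ z)) × EvenVertex (at t (ιₚ w))) ×
          ¬ (¬ EvenVertex (at t (ιₚ z)) × ¬ EvenVertex (at t (ιₚ w)))
        odd-step-parity {t} {z} {w} t∈T odd =
          in-patch (labelling tiling (proj₁ base-tile ∷ t ∷ []) (proj₂ base-tile ∷ t∈T ∷ []))
          where
          Goal : Set
          Goal = ¬ (EvenVertex (at t (ιₚ z)) × EvenVertex (at t (ιₚ w))) ×
                 ¬ (¬ EvenVertex (at t (ιₚ z)) × ¬ EvenVertex (at t (ιₚ w)))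
          in-patch : Σ[ L ∈ Labelling ] All (λ t → ∃ (Labelling.Label L t)) (proj₁ base-tile ∷ t ∷ []) → Goal
          in-patch (L , (_ , ℓ₀) ∷ (_ , ℓ) ∷ []) =
            on-grid (grid-lattice ℓ₀ right°) (grid-lattice ℓ z) (grid-lattice ℓ w)
            where
            open Labelling L
            on-grid : ∃ (Grid base) → ∃ (Grid (at t (ιₚ z))) → ∃ (Grid (at t (ιₚ w))) → Goal
            on-grid (a , ga) (b , gb) (c , gc) =
              (λ (ez , ew) → even⇒¬odd (even-perimeter a b c)
                (even+odd {ab ℤ.+ ac} (even+even {ab} {ac}
                  (EvenDist⇒Even scale ab (grid-dist² ga gb) ez)
                  (EvenDist⇒Even scale ac (grid-dist² ga gc) ew)) odd-bc)) ,
              (λ (oz , ow) → even⇒¬odd (even-perimeter a b c)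
                (even+odd {ab ℤ.+ ac} (odd+odd {ab} {ac} (odd-side gb oz) (odd-side gc ow)) odd-bc))
              where
              ab ac : ℤ
              ab = dist²ℤ a b
              ac = dist²ℤ a c
              odd-side : ∀ {p d} → Grid p d → ¬ EvenVertex p → Odd (dist²ℤ a d)
              odd-side {p} {d} gd o =
                [ (λ even → contradiction (Even⇒EvenDist scale (dist²ℤ a d) (grid-dist² ga gd) even) o)
                , (λ odd → odd) ]′ (even⊎odd (dist²ℤ a d))
              bc : dist²ℤ b c ≡ 5^ scale ℤ.* dist²ℤ z w
              bc = ι-injective (trans (sym (grid-dist² gb gc)) (trans
                (*-congˡ (trans (iso t∈T (ιₚ z) (ιₚ w)) (dist²-ιₚ z w))) (sym (ι-* (5^ scale) (dist²ℤ z w)))))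
              odd-bc : Odd (dist²ℤ b c)
              odd-bc = ≡.subst Odd (≡.sym bc) (odd-* {5^ scale} {dist²ℤ z w} (odd-5^ scale) odd)

      colour : Point → Fin 3
      colour p = pick (em {Special p}) (em {EvenVertex p})

      opaque
        colour-cong : ∀ {p q} → p ≈ₚ q → colour p ≡ colour q
        colour-cong {p} {q} e = pick-cong (em {Special p}) (em {EvenVertex p}) (em {Special q}) (em {EvenVertex q})
          (Special-resp e) (Special-resp (≈ₚ.sym e)) (EvenDist-resp e) (EvenDist-resp (≈ₚ.sym e))

        colour-≢ : ∀ {p q} → IsVertexT p → IsVertexT q → IsEdge T p q → colour p ≢ colour q
        colour-≢ {p} {q} p∈V q∈V edge = differ (edge-step p∈V q∈V edge)
          where
          differ : EdgeStep p q → colour p ≢ colour q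
          differ (t , z , w , t∈T , z∈ , w∈ , z∈K , w∈K , p≈ , q≈ , z≢w , step) =
            pick-≢ (em {Special p}) (em {EvenVertex p}) (em {Special q}) (em {EvenVertex q})
              (λ (sp , sq) → z≢w (specials-coincide {t} {z} {w} t∈T z∈ w∈ z∈K w∈K p≈ q≈ sp sq))
              (cases step)
            where
            Goal : Set
            Goal = (Special p ⊎ Special q) ⊎ (¬ (EvenVertex p × EvenVertex q) × ¬ (¬ EvenVertex p × ¬ EvenVertex q))
            odd-step : Odd (dist²ℤ z w) → Goal
            odd-step odd = inj₂
              ( (λ (ep , eq) → proj₁ parity (EvenDist-resp p≈ ep , EvenDist-resp q≈ eq))
              , (λ (op , oq) → proj₂ parity (op ∘ EvenDist-resp (≈ₚ.sym p≈) , oq ∘ EvenDist-resp (≈ₚ.sym q≈))))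
              where
              parity : ¬ (EvenVertex (at t (ιₚ z)) × EvenVertex (at t (ιₚ w))) ×
                       ¬ (¬ EvenVertex (at t (ιₚ z)) × ¬ EvenVertex (at t (ιₚ w)))
              parity = odd-step-parity {t} {z} {w} t∈T odd
            cases : Step° z w → Goal
            cases (odd-1 d) = odd-step (+ 0 , d)
            cases (odd-5 d) = odd-step (+ 2 , d)
            cases (long-leg ≡.refl ≡.refl) = inj₁ (long-leg-special {t} t∈T p≈ q≈ edge)
            cases (long-leg⁻ ≡.refl ≡.refl) = inj₁ ([ inj₂ , inj₁ ]′
              (long-leg-special {t} t∈T q≈ p≈ (Graph.sym (RP T) {p , p∈V} {q , q∈V} edge)))

        colourable : Colourable (RP T) 3
        colourable = colour ∘ proj₁ , (λ {u} {v} → colour-cong {proj₁ u} {proj₁ v}) ,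
          λ {u} {v} → colour-≢ (proj₂ u) (proj₂ v)

        lower-bound : ∀ m → Colourable (RP T) m → 3 ℕ.≤ m
        lower-bound m (c , _ , proper) = triangle reversed-exists
          where
          triangle : ∃[ t ] ∃[ t′ ] T t × T t′ × Reversed t t′ → 3 ℕ.≤ m
          triangle (t , t′ , t∈T , t′∈T , rev) = three-distinct (c r) (c u) (c l)
            (proper (side-edge {t} t∈T (here ≡.refl) (λ _ ())))
            (proper (side-edge {t} t∈T (there (there (here ≡.refl))) (λ ())))
            -- The long leg is an edge because the reversed partner keeps vertices off its midpoint.
            (proper (side-edge {t} t∈T (there (here ≡.refl)) (λ _ _ → reversed-mid {t} {t′} t∈T t′∈T rev)))
            where
            vertex : ∀ z → z ∈ corners° → ∃ IsVertexT
            vertex z z∈ = at t (ιₚ z) , corner-vertex {t} t∈T z∈ ≈ₚ.refl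
            r u l : ∃ IsVertexT
            r = vertex right° right∈
            u = vertex short° short∈
            l = vertex long° long∈

        chromatic-number : HasChromaticNumber (RP T) 3
        chromatic-number = colourable , lower-bound

theorem5p2 : ExcludedMiddle 0ℓ →
    (ℝ : CompleteOrderedField) →
    (√5 : CompleteOrderedField.Carrier ℝ) →
    CompleteOrderedField.IsSquareRoot ℝ (CompleteOrderedField.5# ℝ) √5 →
    (T : Pred (Plane.Triangle ℝ) 0ℓ) →
    Plane.IsRationalPinwheelTiling ℝ √5 T →
    HasChromaticNumber (Plane.RP ℝ T) 3
theorem5p2 em ℝ √5 (_ , √5²≈5) T tiling = Tiling.chromatic-number T tiling
  where open Geometry.Substitution em ℝ √5 √5²≈5
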